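{- Let $p\geq 2$ and let $G$ be a finite simple $\{pK_2, K_2+P_4\}$-free graph. Then $\chi(G)\leq f_p(\omega(G))$, where $f_p:\mathbb{N}\to\mathbb{N}$ ($p\geq 2$) is defined as follows. First let $g_p$ ($p\geq2$) be given by $g_t(1)=1$ ($t\geq2$), $g_2(2)=3$, $g_2(m)=m$ ($m\geq3$), $g_p(2)=2p-2$ ($p\geq3$), $g_p(m)=g_{p-1}(m)+2m-2$ ($p,m\geq3$). Then $f_t(1)=1$ for $t\geq 2$; $f_2(2)=3$; $f_2(3)=4$; $f_2(s)=s+2$ for $s\geq 4$; $f_p(2)=2p-2$ and $f_p(3)=2p^2-3p+4$ for $p\geq 3$; and $f_p(m)=f_{p-1}(m)+2g_{p-1}(m-1)+3m-6$ for $p\geq 3$, $m\geq 4$.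
   Context: $\chi(G)$ is the chromatic number and $\omega(G)$ the clique number of $G$. $pK_2$ is the disjoint union of $p$ edges; $P_4$ is the path on four vertices; $K_2+P_4$ is the join of an edge and a $P_4$ (disjoint union plus all edges between the two parts). A graph is $\mathcal{F}$-free if it has no induced subgraph isomorphic to a member of $\mathcal{F}$. -}

module Defs where

open import Data.Nat using (ℕ; zero; suc; _+_; _*_; _∸_; _/_; _≡ᵇ_; _<ᵇ_)
open import Data.Bool using (Bool; true; false; _∧_; _∨_; not)
open import Data.Fin using (Fin; toℕ)
open import Data.Product using (Σ; _×_; _,_)
open import Relation.Binary.PropositionalEquality using (_≡_; _≢_)
open import Function.Definitions using (Injective)

Adj : ℕ → Set
Adj n = Fin n → Fin n → Bool

record SimpleGraph (n : ℕ) : Set where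
  field
    adj    : Adj n
    sym    : ∀ u v → adj u v ≡ adj v u
    irrefl : ∀ v → adj v v ≡ false
open SimpleGraph public

ContainsInduced : ∀ {n} → SimpleGraph n → (k : ℕ) → Adj k → Set
ContainsInduced {n} G k H =
  Σ (Fin k → Fin n) λ φ → Injective _≡_ _≡_ φ × (∀ i j → adj G (φ i) (φ j) ≡ H i j)

Free : ∀ {n} → SimpleGraph n → (k : ℕ) → Adj k → Set
Free G k H = ContainsInduced G k H → Data.Empty.⊥
  where import Data.Empty

-- p K₂ : vertices 0 … 2p-1, edges {2i, 2i+1}.
pK₂ : (p : ℕ) → Adj (2 * p)
pK₂ p i j = (toℕ i / 2 ≡ᵇ toℕ j / 2) ∧ not (toℕ i ≡ᵇ toℕ j)

-- K₂ + P₄ (join): vertices 0,1 form the K₂, vertices 2-3-4-5 the path P₄,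
-- and every vertex of {0,1} is adjacent to every vertex of {2,3,4,5}.
K₂+P₄ : Adj 6
K₂+P₄ i j = edge (toℕ i) (toℕ j)
  where
  edge : ℕ → ℕ → Bool
  edge a b with a <ᵇ 2 | b <ᵇ 2
  ... | true  | true  = not (a ≡ᵇ b)
  ... | true  | false = true
  ... | false | true  = true
  ... | false | false = (suc a ≡ᵇ b) ∨ (suc b ≡ᵇ a)

HasClique : ∀ {n} → SimpleGraph n → ℕ → Set
HasClique {n} G k =
  Σ (Fin k → Fin n) λ φ → Injective _≡_ _≡_ φ × (∀ i j → i ≢ j → adj G (φ i) (φ j) ≡ true)

IsCliqueNumber : ∀ {n} → SimpleGraph n → ℕ → Set
IsCliqueNumber G w = HasClique G w × (HasClique G (suc w) → Data.Empty.⊥)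
  where import Data.Empty

-- G admits a proper colouring with k colours (equivalently χ(G) ≤ k).
Colourable : ∀ {n} → SimpleGraph n → ℕ → Set
Colourable {n} G k =
  Σ (Fin n → Fin k) λ c → ∀ u v → adj G u v ≡ true → c u ≢ c v

-- The bounding functions (only meaningful for p ≥ 2, m ≥ 1; other
-- arguments get the junk value 0).

g : ℕ → ℕ → ℕ
g 0 _ = 0
g 1 _ = 0
g 2 0 = 0
g 2 1 = 1
g 2 2 = 3
g 2 (suc (suc (suc k))) = 3 + k
g (suc (suc (suc q))) 0 = 0
g (suc (suc (suc q))) 1 = 1
g (suc (suc (suc q))) 2 = 2 * (3 + q) ∸ 2
g (suc (suc (suc q))) (suc (suc (suc k))) =
  g (suc (suc q)) (3 + k) + (2 * (3 + k) ∸ 2)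

f : ℕ → ℕ → ℕ
f 0 _ = 0
f 1 _ = 0
f 2 0 = 0
f 2 1 = 1
f 2 2 = 3
f 2 3 = 4
f 2 (suc (suc (suc (suc k)))) = (4 + k) + 2
f (suc (suc (suc q))) 0 = 0
f (suc (suc (suc q))) 1 = 1
f (suc (suc (suc q))) 2 = 2 * (3 + q) ∸ 2
f (suc (suc (suc q))) 3 =
  2 * (3 + q) * (3 + q) ∸ 3 * (3 + q) + 4
f (suc (suc (suc q))) (suc (suc (suc (suc k)))) =
  f (suc (suc q)) (4 + k) + 2 * g (suc (suc q)) (3 + k) + (3 * (4 + k) ∸ 6)

private
  module Sanity where
    open import Relation.Binary.PropositionalEquality using (refl)
    t1 : f 2 5 ≡ 7
    t1 = refl
    t2 : f 3 3 ≡ 13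
    t2 = refl
    t3 : f 3 4 ≡ 6 + 2 * 3 + 6
    t3 = refl
    t4 : g 3 3 ≡ 7
    t4 = refl
    t5 : g 4 2 ≡ 6
    t5 = refl

{-# OPTIONS --safe #-}

-- For p ≥ 3 the bound follows by induction on p. A triangle abc covers the graph by three P₄-free sets (the common
-- neighbours of two of a, b, c), two gem-free sets without (p − 1)K₂ (the vertices adjacent to a alone or to b alone) and
-- the set of vertices adjacent to neither a nor b, which has no (p − 1)K₂. A gem-free graph is split in the same way along
-- an edge. P₄-free graphs are coloured greedily, and for p = 2 a vertex is coloured by a suitably chosen member of a
-- maximum clique which it misses.
--
-- This leaves the 4-colourability of (2K₂, K₄)-free and of (3K₂, K₃)-free graphs. In a minimal counterexample fix an
-- induced configuration and sort all vertices by their adjacencies to it. Every assignment of colours to the finitely many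
-- possible types fails, so two types with the same colour are joined by an edge, whose ends enlarge the configuration.
-- This search is finite for both classes, and the resulting trees are verified by evaluating a checker proved sound.

module Submission where

open import Defs renaming (sym to adj-sym)
open import Data.Bool using (Bool; true; false; _∧_; _∨_; not; if_then_else_)
open import Data.Bool.Properties using (T-≡; ¬-not) renaming (_≟_ to _≟ᵇ_)
open import Data.Empty using (⊥; ⊥-elim)
open import Data.Fin using (Fin; zero; suc; toℕ; fromℕ; fromℕ<; inject₁; inject≤; _↑ˡ_; _↑ʳ_; splitAt; punchIn; punchOut)
open import Data.Fin.Induction using (<-weakInduction; >-weakInduction)
open import Data.Fin.Patterns using (0F; 1F; 2F; 3F; 4F; 5F)
open import Data.Fin.Properties using (any?; all?; ¬∀⟶∃¬; inject≤-injective; ↑ˡ-injective; ↑ʳ-injective; splitAt-↑ˡ; splitAt-↑ʳ; punchIn-injective; punchInᵢ≢i; punchIn-punchOut; toℕ<n; toℕ-injective; fromℕ<-injective; fromℕ<-cong) renaming (_≟_ to _≟ᶠ_)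
open import Data.List using (List; []; _∷_; _++_; allFin; drop; filter; length; lookup; map; tabulate; zipWith)
open import Data.List.Membership.Propositional using (_∈_)
open import Data.List.Membership.Propositional.Properties using (∈-filter⁺; ∈-filter⁻; ∈-allFin; ∈-lookup)
open import Data.List.Properties using (length-map; length-++; length-tabulate; ∷-injective)
open import Data.List.Relation.Unary.All using (All; []; _∷_)
import Data.List.Relation.Unary.All as All
import Data.List.Relation.Unary.All.Properties as Allₚ
open import Data.List.Relation.Unary.AllPairs using (AllPairs; []; _∷_; allPairs?)
import Data.List.Relation.Unary.AllPairs.Properties as AllPairsₚ
open import Data.List.Relation.Unary.Any using (here; there; index)
open import Data.List.Relation.Unary.Any.Properties using (lookup-index)
open import Data.Maybe using (Maybe; just; nothing)
open import Data.Nat using (ℕ; zero; suc; _+_; _*_; _∸_; _/_; _%_; _≡ᵇ_; _≤_; _<_; _≥_; z≤n; s≤s; s≤s⁻¹; z<s)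
open import Data.Nat.DivMod using (m<n*o⇒m/o<n; m≡m%n+[m/n]*n; m%n<n)
open import Data.Nat.Properties using (_≟_; _≤?_; _<?_; ≤-refl; ≤-reflexive; ≤-trans; <-irrefl; <⇒≤; ≰⇒>; ≮⇒≥; ≤∧≢⇒<; 1+n≰n; n≤1+n; m≤m+n; m≤n+m; +-comm; +-suc; +-mono-≤; +-cancelˡ-≤; *-comm; m+n∸n≡m; suc-injective; ≡⇒≡ᵇ; ≡ᵇ⇒≡)
open import Data.Nat.Solver using (module +-*-Solver)
open import Data.Product using (Σ; ∃; _×_; _,_; proj₁; proj₂)
open import Data.Sum using (_⊎_; inj₁; inj₂)
open import Data.Unit using (⊤; tt)
open import Function using (_∘_; Equivalence)
open import Function.Definitions using (Injective)
open import Relation.Binary.PropositionalEquality using (_≡_; _≢_; refl; sym; trans; cong; cong₂; subst)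
open import Relation.Nullary using (Dec; yes; no; does; ¬_; ¬?; _×-dec_; _→-dec_)
open import Relation.Nullary.Decidable using (from-yes; map′)

-- The recurrences count the covers. With clique number at most m, a neighbourhood in a gem-free
-- graph costs m - 1 colours, whence 2m - 2 in `g`. At a triangle, the three sets of common
-- neighbours cost m - 2 colours each, whence 3m - 6 in `f`; the other three sets cost g_(p-1)(m-1)
-- twice and f_(p-1)(m) once. The quadratic f_p(3) solves the same recurrence. The starting values
-- are the obstacle. For clique number 2, raising p by one costs two colours, so a start from f_2(2)
-- = 3 would give 5 at p = 3; the value 2p - 2 requires a separate proof that 4 colours suffice
-- there. Likewise, colouring by missed clique members uses four members of the clique and two extra
-- colours, which is too much for f_2(3) = 4. The pieces of a cover may have a smaller clique number
-- than the graph. All bounds are therefore proved for any upper bound m on the clique number, and a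
-- clique too small for a construction is treated as a case of its own.

pull : ∀ {m n} → SimpleGraph n → (Fin m → Fin n) → SimpleGraph m
pull G e = record
  { adj    = λ u v → adj G (e u) (e v)
  ; sym    = λ u v → adj-sym G (e u) (e v)
  ; irrefl = λ v → irrefl G (e v)
  }

-- Forbidden configurations in list form, and their inheritance by induced subgraphs

Apart : ∀ {n} → SimpleGraph n → Fin n × Fin n → Fin n × Fin n → Set
Apart G (a , b) (c , d) =
  adj G a c ≡ false × adj G a d ≡ false × adj G b c ≡ false × adj G b d ≡ false

IsEdge : ∀ {n} → SimpleGraph n → Fin n × Fin n → Set
IsEdge G (a , b) = adj G a b ≡ true

-- Lists of edges, and below lists of vertices for cliques, instead of embeddings: irreflexive
-- adjacency already keeps the vertices distinct, so such a list can be mapped into a larger graph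
-- or extended by a member without proofs of injectivity.
MatchingFree : ∀ {n} → SimpleGraph n → ℕ → Set
MatchingFree G p = ∀ es → All (IsEdge G) es → AllPairs (Apart G) es → length es < p

Clique : ∀ {n} → SimpleGraph n → List (Fin n) → Set
Clique G = AllPairs (λ x y → adj G x y ≡ true)

ω≤ : ∀ {n} → SimpleGraph n → ℕ → Set
ω≤ G m = ∀ xs → Clique G xs → length xs ≤ m

record Path₄ {n} (G : SimpleGraph n) (a b c d : Fin n) : Set where
  constructor path
  field
    ab : adj G a b ≡ true
    bc : adj G b c ≡ true
    cd : adj G c d ≡ true
    ac : adj G a c ≡ false
    ad : adj G a d ≡ false
    bd : adj G b d ≡ false

record Joined {n} (G : SimpleGraph n) (k a b c d : Fin n) : Set where
  constructor joined
  field
    ka : adj G k a ≡ true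
    kb : adj G k b ≡ true
    kc : adj G k c ≡ true
    kd : adj G k d ≡ true

P₄Free GemFree K₂P₄Free : ∀ {n} → SimpleGraph n → Set
P₄Free G = ∀ {a b c d} → Path₄ G a b c d → ⊥
GemFree G = ∀ {k a b c d} → Joined G k a b c d → Path₄ G a b c d → ⊥
K₂P₄Free G = ∀ {k l a b c d} → adj G k l ≡ true → Joined G k a b c d → Joined G l a b c d → Path₄ G a b c d → ⊥

module _ {m n} (G : SimpleGraph n) (e : Fin m → Fin n) where

  pull-clique : ∀ {xs} → Clique (pull G e) xs → Clique G (map e xs)
  pull-clique c = AllPairsₚ.map⁺ c

  pull-matchingFree : ∀ {p} → MatchingFree G p → MatchingFree (pull G e) p
  pull-matchingFree {p} free es edges apart =
    subst (_< p) (length-map _ es)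
      (free (map (λ (a , b) → e a , e b) es) (Allₚ.map⁺ edges) (AllPairsₚ.map⁺ apart))

  pull-ω≤ : ∀ {k} → ω≤ G k → ω≤ (pull G e) k
  pull-ω≤ {k} ω xs c = subst (_≤ k) (length-map e xs) (ω (map e xs) (pull-clique c))

  pull-path : ∀ {a b c d} → Path₄ (pull G e) a b c d → Path₄ G (e a) (e b) (e c) (e d)
  pull-path (path ab bc cd ac ad bd) = path ab bc cd ac ad bd

  pull-joined : ∀ {k a b c d} → Joined (pull G e) k a b c d → Joined G (e k) (e a) (e b) (e c) (e d)
  pull-joined (joined ka kb kc kd) = joined ka kb kc kd

  pull-gemFree : GemFree G → GemFree (pull G e)
  pull-gemFree free j p = free (pull-joined j) (pull-path p)

  pull-K₂P₄Free : K₂P₄Free G → K₂P₄Free (pull G e)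
  pull-K₂P₄Free free kl j j′ p = free kl (pull-joined j) (pull-joined j′) (pull-path p)

-- Colouring vertex sets separately

module _ {n} (G : SimpleGraph n) where

  private
    V : Set
    V = Fin n

  ~-sym : ∀ {x y b} → adj G x y ≡ b → adj G y x ≡ b
  ~-sym {x} {y} e = trans (adj-sym G y x) e

  ¬~-self : ∀ {x} → adj G x x ≡ true → ⊥
  ¬~-self {x} e with trans (sym e) (irrefl G x)
  ... | ()

  ColOn : (V → Bool) → ℕ → Set
  ColOn P k = Σ (∀ v → P v ≡ true → Fin k) λ c → ∀ u v p q → adj G u v ≡ true → c u p ≢ c v q

  record Sub (P : V → Bool) : Set where
    field
      {size} : ℕ
      emb    : Fin size → V
      inside : ∀ i → P (emb i) ≡ true
      cover  : ∀ v → P v ≡ true → ∃ λ i → emb i ≡ v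

  sub : ∀ P → Sub P
  sub P = record
    { emb    = lookup L
    ; inside = λ i → proj₂ (∈-filter⁻ (λ v → P v ≟ᵇ true) {xs = allFin n} (∈-lookup i))
    ; cover  = λ v p → let i = ∈-filter⁺ (λ v → P v ≟ᵇ true) (∈-allFin v) p in index i , sym (lookup-index i)
    }
    where
    L : List V
    L = filter (λ v → P v ≟ᵇ true) (allFin n)

  sub-colOn : ∀ {P k} (S : Sub P) → Colourable (pull G (Sub.emb S)) k → ColOn P k
  sub-colOn S (c , proper) = (λ v p → c (proj₁ (cover v p))) , λ u v p q a →
    proper _ _ (trans (cong₂ (adj G) (proj₂ (cover u p)) (proj₂ (cover v q))) a)
    where open Sub S

  colOn-∨ : ∀ {P Q a b} → ColOn P a → ColOn Q b → ColOn (λ v → P v ∨ Q v) (a + b)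
  colOn-∨ {P} {Q} {a} {b} (c , c-proper) (d , d-proper) = col , proper
    where
    pick : ∀ v x → P v ≡ x → x ∨ Q v ≡ true → Fin (a + b)
    pick v true  p _ = c v p ↑ˡ b
    pick v false _ q = a ↑ʳ d v q

    col : ∀ v → P v ∨ Q v ≡ true → Fin (a + b)
    col v = pick v (P v) refl

    left≢right : ∀ (i : Fin a) (j : Fin b) → i ↑ˡ b ≢ a ↑ʳ j
    left≢right i j e with trans (sym (splitAt-↑ˡ a i b)) (trans (cong (splitAt a) e) (splitAt-↑ʳ a b j))
    ... | ()

    go : ∀ u v x y (p : P u ≡ x) (q : P v ≡ y) (r : x ∨ Q u ≡ true) (s : y ∨ Q v ≡ true) →
         adj G u v ≡ true → pick u x p r ≢ pick v y q s
    go u v true  true  p q r s e eq = c-proper u v p q e (↑ˡ-injective b _ _ eq)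
    go u v true  false p q r s e eq = left≢right _ _ eq
    go u v false true  p q r s e eq = left≢right _ _ (sym eq)
    go u v false false p q r s e eq = d-proper u v r s e (↑ʳ-injective a _ _ eq)

    proper : ∀ u v p q → adj G u v ≡ true → col u p ≢ col v q
    proper u v = go u v (P u) (P v) refl refl

  colOn-all : ∀ {P k} → (∀ v → P v ≡ true) → ColOn P k → Colourable G k
  colOn-all all (c , proper) = (λ v → c v (all v)) , λ u v → proper u v (all u) (all v)

  weaken : ∀ {a b} → a ≤ b → Colourable G a → Colourable G b
  weaken a≤b (c , proper) = (λ v → inject≤ (c v) a≤b) , λ u v e eq → proper u v e (inject≤-injective a≤b a≤b _ _ eq)

  colOn-independent : ∀ {P} → (∀ u v → P u ≡ true → P v ≡ true → adj G u v ≡ true → ⊥) → ColOn P 1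
  colOn-independent indep = (λ _ _ → zero) , λ u v p q e _ → indep u v p q e

  edge? : (∃ λ a → ∃ λ b → adj G a b ≡ true) ⊎ (∀ a b → adj G a b ≡ true → ⊥)
  edge? with any? (λ a → any? (λ b → adj G a b ≟ᵇ true))
  ... | yes (a , b , e) = inj₁ (a , b , e)
  ... | no ¬e           = inj₂ λ a b e → ¬e (a , b , e)

  edgeless-colourable : (∀ a b → adj G a b ≡ true → ⊥) → Colourable G 1
  edgeless-colourable none = (λ _ → zero) , λ u v e _ → none u v e

  -- The edge ab is apart from every edge inside `P`, so an induced matching there can be extended
  -- by ab.
  sub-matchingFree : ∀ {P p} (S : Sub P) a b → adj G a b ≡ true →
    (∀ v → P v ≡ true → adj G v a ≡ false × adj G v b ≡ false) →
    MatchingFree G (suc p) → MatchingFree (pull G (Sub.emb S)) p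
  sub-matchingFree {p = p} S a b ab far free es edges apart =
    s≤s⁻¹ (subst (λ l → suc l < suc p) (length-map _ es)
      (free ((a , b) ∷ map (λ (x , y) → emb x , emb y) es) (ab ∷ Allₚ.map⁺ edges)
        (Allₚ.map⁺ (All.tabulate λ {(x , y)} _ →
           ~-sym (proj₁ (far _ (inside x))) , ~-sym (proj₁ (far _ (inside y))) ,
           ~-sym (proj₂ (far _ (inside x))) , ~-sym (proj₂ (far _ (inside y))))
         ∷ AllPairsₚ.map⁺ apart)))
    where open Sub S

  sub-ω≤ : ∀ {P m} (S : Sub P) ys → Clique G ys → (∀ v → P v ≡ true → All (λ y → adj G y v ≡ true) ys) →
    ω≤ G (length ys + m) → ω≤ (pull G (Sub.emb S)) m
  sub-ω≤ {P} {m} S ys c near ω xs c′ = +-cancel (length ys)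
    (subst (_≤ length ys + m) (len ys) (ω (ys ++ map emb xs) (go ys c near)))
    where
    open Sub S
    +-cancel : ∀ k → k + length xs ≤ k + m → length xs ≤ m
    +-cancel k = +-cancelˡ-≤ k _ _
    len : ∀ ys → length (ys ++ map emb xs) ≡ length ys + length xs
    len ys = trans (length-++ ys) (cong (length ys +_) (length-map emb xs))
    go : ∀ ys → Clique G ys → (∀ v → P v ≡ true → All (λ y → adj G y v ≡ true) ys) → Clique G (ys ++ map emb xs)
    go []       _        _    = AllPairsₚ.map⁺ c′
    go (y ∷ ys) (a ∷ cl) near =
      Allₚ.++⁺ a (Allₚ.map⁺ (All.tabulate λ {x} _ → All.head (near _ (inside x)))) ∷ go ys cl λ v p → All.tail (near v p)

-- Greedy colourings of P₄-free graphs

record Greedy {n} (G : SimpleGraph n) : Set where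
  field
    colour : Fin n → ℕ
    proper : ∀ u v → adj G u v ≡ true → colour u ≢ colour v
    greedy : ∀ v i → i < colour v → ∃ λ u → adj G u v ≡ true × colour u ≡ i

module _ {n} (G : SimpleGraph n) (free : P₄Free G) (γ : Greedy G) where
  open Greedy γ

  -- If x misses q and y misses q′ then x, q′, q, y is an induced P₄.
  common-neighbour : ∀ i q Q → Clique G (q ∷ Q) → All (λ v → i < colour v) (q ∷ Q) →
    ∃ λ x → colour x ≡ i × All (λ v → adj G x v ≡ true) (q ∷ Q)
  common-neighbour i q [] _ (h ∷ []) with greedy q i h
  ... | x , xq , cx = x , cx , xq ∷ []
  common-neighbour i q (r ∷ Q) (qr ∷ cl) (h ∷ hs) with common-neighbour i r Q cl hs
  ... | x , cx , xs with adj G x q in eq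
  ... | true  = x , cx , eq ∷ xs
  ... | false with greedy q i h
  ... | y , yq , cy = y , cy , yq ∷ All.zipWith (λ (p , q) → step p q) (xs , qr)
    where
    step : ∀ {s} → adj G x s ≡ true → adj G q s ≡ true → adj G y s ≡ true
    step {s} xs qs with adj G y s in ys
    ... | true  = refl
    ... | false with adj G x y in xy
    ...   | true  = ⊥-elim (proper x y xy (trans cx (sym cy)))
    ...   | false = ⊥-elim (free (path xs (~-sym G qs) (~-sym G yq) eq xy (~-sym G ys)))

  -- Each round adds to the clique a common neighbour one colour lower, until colour 0 is reached.
  -- Started at a single vertex of colour i, this produces a clique of i + 1 vertices, which is what
  -- bounds the colours.
  descend : ∀ i q Q → Clique G (q ∷ Q) → All (λ v → i ≤ colour v) (q ∷ Q) →
    ∃ λ xs → Clique G xs × length xs ≡ i + length (q ∷ Q)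
  descend zero    q Q cl h = q ∷ Q , cl , refl
  descend (suc i) q Q cl h with common-neighbour i q Q cl h
  ... | x , cx , xs with descend i x (q ∷ Q) (xs ∷ cl) (subst (i ≤_) (sym cx) ≤-refl ∷ All.map <⇒≤ h)
  ... | ys , cl′ , len = ys , cl′ , trans len (+-suc i _)

  colour<ω : ∀ {m} → ω≤ G m → ∀ v → colour v < m
  colour<ω {m} ω v with descend (colour v) v [] ([] ∷ []) (≤-refl ∷ [])
  ... | xs , cl , len = subst (_≤ m) (trans len (+-comm _ 1)) (ω xs cl)

least-missing : ∀ {P : ℕ → Set} → (∀ i → Dec (P i)) → ∀ b → ¬ P b → ∃ λ i → ¬ P i × ∀ j → j < i → P j
least-missing {P} P? b ¬Pb with go b
  where
  go : ∀ b → (∃ λ i → ¬ P i × ∀ j → j < i → P j) ⊎ (∀ j → j < b → P j)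
  go zero    = inj₂ λ _ ()
  go (suc b) with go b
  ... | inj₁ r = inj₁ r
  ... | inj₂ h with P? b
  ... | no ¬p = inj₁ (b , ¬p , h)
  ... | yes p = inj₂ λ j j<1+b → case j j<1+b (j ≟ b)
    where
    case : ∀ j → j < suc b → Dec (j ≡ b) → P j
    case j lt (yes refl) = p
    case j lt (no j≢b)   = h j (≤∧≢⇒< (s≤s⁻¹ lt) j≢b)
... | inj₁ r = r
... | inj₂ h = b , ¬Pb , h

greedyColouring : ∀ n (G : SimpleGraph n) → P₄Free G → ∀ m → ω≤ G m → Greedy G
greedyColouring zero    G free m ω = record { colour = λ () ; proper = λ () ; greedy = λ () }
greedyColouring (suc n) G free m ω = record { colour = col ; proper = col-proper ; greedy = col-greedy }
  where
  H = pull G suc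
  H-free : P₄Free H
  H-free p = free (pull-path G suc p)
  γ = greedyColouring n H H-free m (pull-ω≤ G suc ω)
  open Greedy γ
  Used : ℕ → Set
  Used i = ∃ λ u → adj G (suc u) zero ≡ true × colour u ≡ i
  used? : ∀ i → Dec (Used i)
  used? i = any? λ u → (adj G (suc u) zero ≟ᵇ true) ×-dec (colour u ≟ i)
  new : ∃ λ i → ¬ Used i × ∀ j → j < i → Used j
  new = least-missing used? m λ (u , _ , e) → <-irrefl e (colour<ω H H-free γ (pull-ω≤ G suc ω) u)
  col : Fin (suc n) → ℕ
  col zero    = proj₁ new
  col (suc u) = colour u
  col-proper : ∀ u v → adj G u v ≡ true → col u ≢ col v
  col-proper zero    zero    e _  = ¬~-self G e
  col-proper zero    (suc v) e eq = proj₁ (proj₂ new) (v , ~-sym G e , sym eq)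
  col-proper (suc u) zero    e eq = proj₁ (proj₂ new) (u , e , eq)
  col-proper (suc u) (suc v) e eq = proper u v e eq
  col-greedy : ∀ v i → i < col v → ∃ λ u → adj G u v ≡ true × col u ≡ i
  col-greedy zero    i lt = let u , e , eq = proj₂ (proj₂ new) i lt in suc u , e , eq
  col-greedy (suc v) i lt = let u , e , eq = greedy v i lt in suc u , e , eq

P₄Free-colourable : ∀ {n} (G : SimpleGraph n) m → P₄Free G → ω≤ G m → Colourable G m
P₄Free-colourable {n} G m free ω =
  (λ v → fromℕ< (colour<ω G free γ ω v)) ,
  λ u v e eq → proper u v e (fromℕ<-injective _ _ (colour<ω G free γ ω u) (colour<ω G free γ ω v) eq)
  where
  γ = greedyColouring n G free m ω
  open Greedy γ

-- Excluding 2K₂: colouring by the members of a maximum clique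

true≢false : ∀ {b} → b ≡ true → b ≡ false → ⊥
true≢false refl ()

-- The cyclic predecessor. In the gem-free case the maximum clique is arranged in a cycle, and a
-- vertex is coloured by a place where a run of missed members begins.
cpred : ∀ {n} → Fin (suc n) → Fin (suc n)
cpred {n} zero = fromℕ n
cpred (suc i)  = inject₁ i

-- If 0 were outside the set, induction upwards would leave it empty. So 0 is inside, hence also its
-- predecessor, the largest index, and then everything below.
cpred-closed : ∀ {n} (P : Fin (suc n) → Bool) → (∀ i → P i ≡ true → P (cpred i) ≡ true) →
               ∀ i → P i ≡ true → ∀ j → P j ≡ true
cpred-closed P closed i Pi =
  >-weakInduction (λ j → P j ≡ true) (closed zero at-zero) λ j → closed (suc j)
  where
  at-zero : P zero ≡ true
  at-zero with P zero in eq
  ... | true  = refl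
  ... | false = ⊥-elim (true≢false Pi
    (<-weakInduction (λ j → P j ≡ false) eq (λ j e → ¬-not (λ e′ → true≢false (closed (suc j) e′) e)) i))

module MaximumClique {n} (G : SimpleGraph n) (two : MatchingFree G 2) {w} (κ : Fin (suc w) → Fin n)
  (κ-adj : ∀ {i j} → i ≢ j → adj G (κ i) (κ j) ≡ true) (ω : ω≤ G (suc w)) where

  private
    V : Set
    V = Fin n

  missed : ∀ x → ∃ λ i → adj G x (κ i) ≡ false
  missed x with any? (λ i → adj G x (κ i) ≟ᵇ false)
  ... | yes m = m
  ... | no ¬m = ⊥-elim (1+n≰n (subst (λ l → suc l ≤ suc w) (length-tabulate κ)
    (ω (x ∷ tabulate κ) (Allₚ.tabulate⁺ (λ i → ¬-not (λ e → ¬m (i , e))) ∷ AllPairsₚ.tabulate⁺ κ-adj))))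

  no-2K₂ : ∀ {x y i j} → adj G x y ≡ true → i ≢ j →
    adj G x (κ i) ≡ false → adj G y (κ i) ≡ false → adj G x (κ j) ≡ false → adj G y (κ j) ≡ false → ⊥
  no-2K₂ {x} {y} {i} {j} xy i≢j xi yi xj yj =
    1+n≰n (two ((x , y) ∷ (κ i , κ j) ∷ []) (xy ∷ κ-adj i≢j ∷ []) (((xi , xj , yi , yj) ∷ []) ∷ [] ∷ []))

  -- If x and y miss only κ i, putting both in its place enlarges the clique; if they also miss κ j,
  -- the edges xy and κ i κ j form a 2K₂.
  no-twins : ∀ {x y i} → adj G x y ≡ true → adj G x (κ i) ≡ false → (∀ j → adj G x (κ j) ≡ adj G y (κ j)) → ⊥
  no-twins {x} {y} {i} xy xi same with any? (λ j → ¬? (i ≟ᶠ j) ×-dec (adj G x (κ j) ≟ᵇ false))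
  ... | yes (j , i≢j , xj) = no-2K₂ xy i≢j xi (trans (sym (same i)) xi) xj (trans (sym (same j)) xj)
  ... | no none = 1+n≰n (subst (λ l → suc (suc l) ≤ suc w) (length-tabulate (κ ∘ punchIn i))
    (ω (x ∷ y ∷ tabulate (κ ∘ punchIn i))
      ((xy ∷ Allₚ.tabulate⁺ near) ∷ Allₚ.tabulate⁺ (λ j → trans (sym (same _)) (near j)) ∷
       AllPairsₚ.tabulate⁺ (λ j≢k → κ-adj (j≢k ∘ punchIn-injective i _ _)))))
    where
    near : ∀ j → adj G x (κ (punchIn i j)) ≡ true
    near j = ¬-not λ e → none (punchIn i j , punchInᵢ≢i i j ∘ sym , e)

  Splitter : V → V → Fin (suc w) → Set
  Splitter x y j = adj G x (κ j) ≡ true × adj G y (κ j) ≡ false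

  no-splitter⇒⊥ : ∀ {x y i} → adj G x y ≡ true → adj G x (κ i) ≡ false →
    (∀ j → Splitter x y j → ⊥) → (∀ j → Splitter y x j → ⊥) → ⊥
  no-splitter⇒⊥ {x} {y} xy xi s s′ = no-twins xy xi same
    where
    same : ∀ j → adj G x (κ j) ≡ adj G y (κ j)
    same j with adj G x (κ j) in ex | adj G y (κ j) in ey
    ... | true  | true  = refl
    ... | false | false = refl
    ... | true  | false = ⊥-elim (s j (ex , ey))
    ... | false | true  = ⊥-elim (s′ j (ey , ex))

  κ-adj′ : ∀ {x i j} → adj G x (κ i) ≡ true → adj G x (κ j) ≡ false → adj G (κ i) (κ j) ≡ true
  κ-adj′ p q = κ-adj λ where refl → true≢false p q

  splitter-path : ∀ {x y i j} → adj G x y ≡ true → adj G x (κ i) ≡ false → adj G y (κ i) ≡ false →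
    Splitter x y j → Path₄ G (κ i) (κ j) x y
  splitter-path xy xi yi (xj , yj) =
    path (~-sym G (κ-adj′ xj xi)) (~-sym G xj) xy (~-sym G xi) (~-sym G yi) (~-sym G yj)

  splitter-joined : ∀ {x y i j k} → adj G x (κ i) ≡ false → adj G x (κ k) ≡ true → adj G y (κ k) ≡ true →
    Splitter x y j → Joined G (κ k) (κ i) (κ j) x y
  splitter-joined xi xk yk (xj , yj) =
    joined (κ-adj′ xk xi) (κ-adj′ yk yj) (~-sym G xk) (~-sym G yk)

  module _ (gem : GemFree G) where

    -- Since x and y are not twins, some κ j is adjacent to exactly one of them, say x. Then κ i, κ
    -- j, x, y is an induced path, and κ k is adjacent to all of it.
    gem-apart : ∀ {x y i k} → adj G x y ≡ true → adj G x (κ i) ≡ false → adj G y (κ i) ≡ false →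
      adj G x (κ k) ≡ true → adj G y (κ k) ≡ true → ⊥
    gem-apart xy xi yi xk yk = no-splitter⇒⊥ xy xi
      (λ j s → gem (splitter-joined xi xk yk s) (splitter-path xy xi yi s))
      (λ j s → gem (splitter-joined yi yk xk s) (splitter-path (~-sym G xy) yi xi s))

    -- Two vertices starting at the same i both miss κ i and share the neighbour κ (cpred i), so gem-apart applies.
    Start : V → Fin (suc w) → Set
    Start x i = adj G x (κ i) ≡ false × adj G x (κ (cpred i)) ≡ true

    start? : ∀ x → Dec (∃ (Start x))
    start? x = any? λ i → (adj G x (κ i) ≟ᵇ false) ×-dec (adj G x (κ (cpred i)) ≟ᵇ true)

    no-start⇒far : ∀ x → ¬ ∃ (Start x) → ∀ i → adj G x (κ i) ≡ false
    no-start⇒far x none i = not-injective-true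
      (cpred-closed (λ j → not (adj G x (κ j))) closed (proj₁ (missed x)) (cong not (proj₂ (missed x))) i)
      where
      not-injective-true : ∀ {b} → not b ≡ true → b ≡ false
      not-injective-true {false} _ = refl
      closed : ∀ j → not (adj G x (κ j)) ≡ true → not (adj G x (κ (cpred j))) ≡ true
      closed j e with adj G x (κ (cpred j)) in eq
      ... | false = refl
      ... | true  = ⊥-elim (none (j , not-injective-true e , eq))

    start : ∀ y → Dec (∃ (Start y)) → Fin (suc w) → Set
    start y (yes (i , _)) j = i ≡ j
    start y (no _)        j = ⊥

    Blocks : V → Fin (suc w) → V → Set
    Blocks x i y = adj G x y ≡ true × start y (start? y) i

    blocks? : ∀ x i y → Dec (Blocks x i y)
    blocks? x i y = (adj G x y ≟ᵇ true) ×-dec dec (start? y)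
      where
      dec : ∀ d → Dec (start y d i)
      dec (yes (j , _)) = j ≟ᶠ i
      dec (no _)        = no λ ()

    start-misses : ∀ {y i} d → start y d i → adj G y (κ i) ≡ false
    start-misses (yes (i , (m , _))) refl = m

    -- x misses the whole clique and y misses κ i, so a second member missed by y would complete a
    -- 2K₂ containing xy.
    start-hits : ∀ {x y i} → (∀ j → adj G x (κ j) ≡ false) → Blocks x i y → ∀ j → i ≢ j → adj G y (κ j) ≡ true
    start-hits {x} {y} {i} far (xy , s) j i≢j = ¬-not λ e →
      no-2K₂ xy i≢j (far i) (start-misses (start? y) s) (far j) e

    -- Otherwise the blocking vertices together with x would form a clique larger than κ.
    free-colour : (∀ i j → ∃ λ k → i ≢ k × j ≢ k) → ∀ x → (∀ i → adj G x (κ i) ≡ false) → ∃ λ i → ¬ ∃ (Blocks x i)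
    free-colour third x far = ¬∀⟶∃¬ (suc w) (λ i → ∃ (Blocks x i)) (λ i → any? (blocks? x i)) λ all →
      let y  = λ i → proj₁ (all i)
          bl = λ i → proj₂ (all i)
          miss = λ i → start-misses (start? (y i)) (proj₂ (bl i))
          hit  = λ {i} {j} → start-hits far (bl i) j
          -- If y i and y j were nonadjacent, y i, κ j, κ i, y j would be an induced path in the
          -- neighbourhood of a third member κ k: a gem.
          y-adj : ∀ {i j} → i ≢ j → adj G (y i) (y j) ≡ true
          y-adj {i} {j} i≢j = ¬-not λ e → let k , i≢k , j≢k = third i j in
            gem (joined (~-sym G (hit i≢k)) (κ-adj (j≢k ∘ sym)) (κ-adj (i≢k ∘ sym)) (~-sym G (hit j≢k)))
                (path (hit i≢j) (κ-adj (i≢j ∘ sym)) (~-sym G (hit (i≢j ∘ sym)))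
                      (miss i) e (~-sym G (miss j)))
      in 1+n≰n (subst (λ l → suc l ≤ suc w) (length-tabulate y)
           (ω (x ∷ tabulate y) (Allₚ.tabulate⁺ (λ i → proj₁ (bl i)) ∷ AllPairsₚ.tabulate⁺ y-adj)))

    -- A vertex without a start misses the whole clique and takes a colour used by none of its
    -- neighbours that have a start. Two such vertices are never adjacent: their edge and κ i₀ κ i₁
    -- would form a 2K₂.
    gemFree-colourable : (∀ i j → ∃ λ k → i ≢ k × j ≢ k) → ∀ (i₀ i₁ : Fin (suc w)) → i₀ ≢ i₁ → Colourable G (suc w)
    gemFree-colourable third i₀ i₁ i₀≢i₁ = (λ x → col x (start? x)) , λ x y → go x y (start? x) (start? y) refl refl
      where
      col : ∀ x → Dec (∃ (Start x)) → Fin (suc w)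
      col x (yes (i , _)) = i
      col x (no none)     = proj₁ (free-colour third x (no-start⇒far x none))
      go : ∀ x y d e → start? x ≡ d → start? y ≡ e → adj G x y ≡ true → col x d ≢ col y e
      go x y (yes (i , xi , xk)) (yes (.i , yi , yk)) _ _ xy refl = gem-apart xy xi yi xk yk
      go x y (yes (i , s)) (no none) q _ xy eq = proj₂ (free-colour third y (no-start⇒far y none))
        (x , ~-sym G xy , subst (λ d → start x d (col y (no none))) (sym q) eq)
      go x y (no none) (yes (i , s)) _ q xy eq = proj₂ (free-colour third x (no-start⇒far x none))
        (y , xy , subst (λ d → start y d (col x (no none))) (sym q) (sym eq))
      go x y (no nx) (no ny) _ _ xy _ = no-2K₂ xy i₀≢i₁
        (no-start⇒far x nx i₀) (no-start⇒far y ny i₀) (no-start⇒far x nx i₁) (no-start⇒far y ny i₁)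

  module _ (free : K₂P₄Free G) where

    -- The path of `gem-apart` again; two common neighbours in the clique now supply the K₂ of the
    -- join.
    K₂P₄-apart : ∀ {x y i k l} → adj G x y ≡ true → adj G x (κ i) ≡ false → adj G y (κ i) ≡ false → k ≢ l →
      adj G x (κ k) ≡ true → adj G y (κ k) ≡ true → adj G x (κ l) ≡ true → adj G y (κ l) ≡ true → ⊥
    K₂P₄-apart xy xi yi k≢l xk yk xl yl = no-splitter⇒⊥ xy xi
      (λ j s → free (κ-adj k≢l) (splitter-joined xi xk yk s) (splitter-joined xi xl yl s) (splitter-path xy xi yi s))
      (λ j s → free (κ-adj k≢l) (splitter-joined yi yk xk s) (splitter-joined yi yl xl s) (splitter-path (~-sym G xy) yi xi s))

-- With T(x) the set of members of the clique missed by x, a vertex is coloured by a member i of T(x) such that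
-- both mates of i are outside T(x); the two extra colours take the vertices with {0,1} ⊆ T(x) or {2,3} ⊆ T(x).
mates : ∀ {k} → Fin (4 + k) → Fin (4 + k) × Fin (4 + k)
mates zero                      = suc zero , suc (suc (suc zero))
mates (suc zero)                = zero , suc (suc zero)
mates (suc (suc zero))          = zero , suc (suc (suc zero))
mates (suc (suc (suc zero)))    = suc zero , suc (suc zero)
mates (suc (suc (suc (suc _)))) = zero , suc zero

mates-distinct : ∀ {k} (i : Fin (4 + k)) → proj₁ (mates i) ≢ proj₂ (mates i)
mates-distinct zero                      ()
mates-distinct (suc zero)                ()
mates-distinct (suc (suc zero))          ()
mates-distinct (suc (suc (suc zero)))    ()
mates-distinct (suc (suc (suc (suc _)))) ()

K₂P₄Free-colourable : ∀ {n k} (G : SimpleGraph n) → MatchingFree G 2 → K₂P₄Free G → (κ : Fin (4 + k) → Fin n) →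
  (∀ {i j} → i ≢ j → adj G (κ i) (κ j) ≡ true) → ω≤ G (4 + k) → Colourable G ((4 + k) + 2)
K₂P₄Free-colourable {n} {k} G two free κ κ-adj ω = (λ x → code (class x)) , λ x y → proper x y (class x) (class y)
  where
  open MaximumClique G two κ κ-adj ω
  i0 i1 i2 i3 : Fin (4 + k)
  i0 = zero
  i1 = suc zero
  i2 = suc (suc zero)
  i3 = suc (suc (suc zero))
  Good : Fin n → Fin (4 + k) → Set
  Good x i = adj G x (κ i) ≡ false × adj G x (κ (proj₁ (mates i))) ≡ true × adj G x (κ (proj₂ (mates i))) ≡ true
  data Class (x : Fin n) : Set where
    low  : adj G x (κ i0) ≡ false → adj G x (κ i1) ≡ false → Class x
    high : adj G x (κ i2) ≡ false → adj G x (κ i3) ≡ false → Class x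
    good : ∀ i → Good x i → Class x
  class : ∀ x → Class x
  -- Outside `low` and `high`, at most one of 0, 1 and at most one of 2, 3 is missed. If 0 and 3 are
  -- missed, the colour must be 3, as 3 is a mate of 0; if 1 and 2 are missed, it must be 2, as 2 is
  -- a mate of 1.
  class x with adj G x (κ i0) in e0 | adj G x (κ i1) in e1 | adj G x (κ i2) in e2 | adj G x (κ i3) in e3
  ... | false | false | _     | _     = low e0 e1
  ... | _     | _     | false | false = high e2 e3
  ... | false | true  | _     | true  = good i0 (e0 , e1 , e3)
  ... | false | true  | true  | false = good i3 (e3 , e1 , e2)
  ... | true  | false | true  | _     = good i1 (e1 , e0 , e2)
  ... | true  | false | false | true  = good i2 (e2 , e0 , e3)
  ... | true  | true  | false | true  = good i2 (e2 , e0 , e3)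
  ... | true  | true  | true  | false = good i3 (e3 , e1 , e2)
  -- A missed member must lie beyond the first four, and its mates 0 and 1 are adjacent to x.
  ... | true  | true  | true  | true  with missed x
  ...   | zero                      , m = ⊥-elim (true≢false e0 m)
  ...   | suc zero                  , m = ⊥-elim (true≢false e1 m)
  ...   | suc (suc zero)            , m = ⊥-elim (true≢false e2 m)
  ...   | suc (suc (suc zero))      , m = ⊥-elim (true≢false e3 m)
  ...   | i@(suc (suc (suc (suc _)))) , m = good i (m , e0 , e1)
  code : ∀ {x} → Class x → Fin ((4 + k) + 2)
  code (low _ _)  = (4 + k) ↑ʳ zero
  code (high _ _) = (4 + k) ↑ʳ suc zero
  code (good i _) = i ↑ˡ 2
  ↑ˡ≢↑ʳ : ∀ (i : Fin (4 + k)) (j : Fin 2) → i ↑ˡ 2 ≢ (4 + k) ↑ʳ j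
  ↑ˡ≢↑ʳ i j e with trans (sym (splitAt-↑ˡ (4 + k) i 2)) (trans (cong (splitAt (4 + k)) e) (splitAt-↑ʳ (4 + k) 2 j))
  ... | ()
  proper : ∀ x y (c : Class x) (d : Class y) → adj G x y ≡ true → code c ≢ code d
  proper x y (low x0 x1)  (low y0 y1)  xy _  = no-2K₂ xy (λ ()) x0 y0 x1 y1
  proper x y (high x2 x3) (high y2 y3) xy _  = no-2K₂ xy (λ ()) x2 y2 x3 y3
  proper x y (low _ _)    (high _ _)   _  eq with ↑ʳ-injective (4 + k) (zero {1}) (suc zero) eq
  ... | ()
  proper x y (high _ _)   (low _ _)    _  eq with ↑ʳ-injective (4 + k) (suc zero) (zero {1}) eq
  ... | ()
  proper x y (low _ _)    (good i _)   _  eq = ↑ˡ≢↑ʳ i _ (sym eq)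
  proper x y (high _ _)   (good i _)   _  eq = ↑ˡ≢↑ʳ i _ (sym eq)
  proper x y (good i _)   (low _ _)    _  eq = ↑ˡ≢↑ʳ i _ eq
  proper x y (good i _)   (high _ _)   _  eq = ↑ˡ≢↑ʳ i _ eq
  proper x y (good i (xi , xk , xl)) (good j gy) xy eq with ↑ˡ-injective 2 i j eq
  proper x y (good i (xi , xk , xl)) (good .i (yi , yk , yl)) xy eq | refl =
    K₂P₄-apart free xy xi yi (mates-distinct i) xk yk xl yl

-- Refutation trees and their checker

Bits : Set
Bits = List Bool

-- The type of a vertex relative to a configuration: its adjacencies to the vertices of the configuration, and the
-- truth values of the predicates.
Ty : Set
Ty = Bits × Bits

-- Entries are listed newest first. An entry real t adds a vertex of type t to the configuration; pseudo D S adds the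
-- predicate "has a type in D and a neighbour with a type in S"; ban s t records that vertices of types s and t are
-- nonadjacent.
data Entry : Set where
  real   : Ty → Entry
  pseudo : List Ty → List Ty → Entry
  ban    : Ty → Ty → Entry

-- Types are referred to by their position in the list of possible types, configuration vertices and predicates by their
-- position in the configuration.
--   leaf c          colour every type, by the base 4 digits of c
--   rem i s r       s: some vertex has type i; r: none has
--   ban i j s r     s: there is an edge between types i and j; r: there is none
--   wit x j ts      vertex x satisfies predicate j: one tree for each possible type of a witness
--   pseudo D S r    introduce a predicate
--   cmp u v         every neighbour of u is a neighbour of v, so a colouring of the graph without u extends to u
--   lem l is        the vertices at positions is induce the graph l, already refuted
data Tree : Set where
  leaf   : ℕ → Tree
  rem    : ℕ → Tree → Tree → Tree
  ban    : ℕ → ℕ → Tree → Tree → Tree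
  wit    : ℕ → ℕ → List Tree → Tree
  pseudo : List ℕ → List ℕ → Tree → Tree
  cmp    : ℕ → ℕ → Tree
  lem    : ℕ → List ℕ → Tree

-- A graph containing two distinguished vertices x and y, as the list of its other vertices: adjacencies to x and y, and
-- to the later vertices of the list.
Pat : Set
Pat = List ((Bool × Bool) × Bits)

nth : ∀ {A : Set} → List A → ℕ → Maybe A
nth []       _       = nothing
nth (x ∷ _)  zero    = just x
nth (_ ∷ xs) (suc i) = nth xs i

eqᵇ : Bool → Bool → Bool
eqᵇ true  b = b
eqᵇ false b = not b

eqBits : Bits → Bits → Bool
eqBits []       []       = true
eqBits (x ∷ xs) (y ∷ ys) = eqᵇ x y ∧ eqBits xs ys
eqBits _        _        = false

eqTy : Ty → Ty → Bool
eqTy (a , b) (c , d) = eqBits a c ∧ eqBits b d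

elem : Ty → List Ty → Bool
elem t []      = false
elem t (s ∷ L) = eqTy t s ∨ elem t L

at : List Ty → ℕ → Ty
at []      _       = [] , []
at (a ∷ _) zero    = a
at (_ ∷ A) (suc i) = at A i

refine : Bits → Bits → List Bits → List Bits
refine row (d ∷ ds) (m ∷ ms) = zipWith (λ r c → c ∧ eqᵇ r d) row m ∷ refine row ds ms
refine _   _        ms       = ms

anyRow : List Bits → Bits → (Bits → Bool) → Bool
anyRow (row ∷ M) (b ∷ m) p = (b ∧ p row) ∨ anyRow M m p
anyRow _         _       _ = false

-- Backtracking search for a pattern among the configuration vertices: each mask holds the
-- candidates for one pattern vertex still to be placed, and `refine` narrows the masks by the row
-- of the vertex just placed.
find : List Bits → List Bits → List Bits → Bool
find M []         _        = true
find M (_ ∷ _)    []       = false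
find M (ds ∷ dss) (m ∷ ms) = anyRow M m (λ row → find M dss (refine row ds ms))

mask : Bits → Bits → Bool × Bool → Bits
mask a b (p , q) = zipWith (λ x y → eqᵇ x p ∧ eqᵇ y q) a b

found : List Bits → Bits → Bits → List Pat → Bool
found M a b []         = false
found M a b (pat ∷ ps) = find M (map proj₂ pat) (map (λ v → mask a b (proj₁ v)) pat) ∨ found M a b ps

extM : Bits → List Bits → List Bits
extM r M = (false ∷ r) ∷ zipWith _∷_ r M

-- The demands of predicates and bans on an edge: if one end has a type in `S` and the other a type
-- in `D`, the latter satisfies the predicate. A `real` entry only strips its bit, so that older
-- entries see the types of their own stage.
consistent : List Entry → Ty → Ty → Bool
consistent []                (a , as)     (b , bs)     = true
consistent (real _ ∷ Es)     (_ ∷ a , as) (_ ∷ b , bs) = consistent Es (a , as) (b , bs)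
consistent (pseudo D S ∷ Es) (a , x ∷ as) (b , y ∷ bs) =
  not (elem (a , as) S ∧ elem (b , bs) D ∧ not y) ∧
  not (elem (b , bs) S ∧ elem (a , as) D ∧ not x) ∧
  consistent Es (a , as) (b , bs)
consistent (ban s t ∷ Es) a b =
  not (eqTy a s ∧ eqTy b t) ∧ not (eqTy a t ∧ eqTy b s) ∧ consistent Es a b
consistent _ _ _ = true

consᵗ : Bool → Ty → Ty
consᵗ x (a , as) = x ∷ a , as

add : Bool → Ty → List Ty → List Ty
add true  a A = a ∷ A
add false a A = A

remove : Ty → List Ty → List Ty
remove t []      = []
remove t (a ∷ A) = add (not (eqTy a t)) a (remove t A)

branch : List Ty → List Ty → List Ty
branch D []             = []
branch D ((a , as) ∷ A) = (a , false ∷ as) ∷ add (elem (a , as) D) (a , true ∷ as) (branch D A)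

bitAt : Bits → ℕ → Bool
bitAt []       _       = false
bitAt (b ∷ _)  zero    = b
bitAt (_ ∷ bs) (suc i) = bitAt bs i

-- The list `S` of witness types of a predicate, with the numbers of vertex bits and predicate bits
-- to drop from a current type in order to return to the stage at which `S` was recorded.
Target : Set
Target = List Ty × ℕ × ℕ

overReal overPseudo : Maybe Target → Maybe Target
overReal   (just (S , i , j)) = just (S , suc i , j)
overReal   nothing            = nothing
overPseudo (just (S , i , j)) = just (S , i , suc j)
overPseudo nothing            = nothing

targetBelow : List Entry → Bits → ℕ → Maybe Target
targetBelow (real _ ∷ Es)     bs           j       = overReal (targetBelow Es bs j)
targetBelow (pseudo D S ∷ Es) (b ∷ bs)     zero    = if b then just (S , 0 , 1) else nothing
targetBelow (pseudo D S ∷ Es) (_ ∷ bs)     (suc j) = overPseudo (targetBelow Es bs j)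
targetBelow (ban _ _ ∷ Es)    bs           j       = targetBelow Es bs j
targetBelow _                 _            _       = nothing

-- The type of vertex x records only predicates older than x; for a newer one there is nothing to
-- read.
target : List Entry → ℕ → ℕ → Maybe Target
target (real (_ , bs) ∷ Es) zero    j       = overReal (targetBelow Es bs j)
target (real _ ∷ Es)        (suc x) j       = overReal (target Es x j)
target (pseudo _ _ ∷ Es)    x       (suc j) = overPseudo (target Es x j)
target (ban _ _ ∷ Es)       x       j       = target Es x j
target _                    _       _       = nothing

hits : Target → ℕ → Ty → Bool
hits (S , i , j) x (a , as) = bitAt a x ∧ elem (drop i a , drop j as) S

hitting : Target → ℕ → List Ty → List Ty
hitting w x []      = []
hitting w x (a ∷ A) = add (hits w x a) a (hitting w x A)

allBits : ℕ → ℕ → List Ty → Bool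
allBits u v []            = true
allBits u v ((a , _) ∷ A) = (not (bitAt a u) ∨ bitAt a v) ∧ allBits u v A

-- Two positions of the configuration may hold the same vertex. Different rows certify that they do
-- not, as the comparison of neighbourhoods needs.
cmpRows : Maybe Bits → Maybe Bits → Bool
cmpRows (just r) (just s) = not (eqBits r s)
cmpRows _        _        = false

matchRow : Bits → List ℕ → Bits → Bool
matchRow row []       []       = true
matchRow row (i ∷ is) (d ∷ ds) = eqᵇ (bitAt row i) d ∧ matchRow row is ds
matchRow row _        _        = false

matchMaybe : Maybe Bits → List ℕ → Bits → Bool
matchMaybe (just row) is ds = matchRow row is ds
matchMaybe nothing    _  _  = false

matches : List Bits → List ℕ → List Bits → Bool
matches M []       []       = true
matches M (i ∷ is) (ds ∷ F) = matchMaybe (nth M i) is ds ∧ matches M is F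
matches M _        _        = false

matchLemma : List Bits → List ℕ → Maybe (List Bits) → Bool
matchLemma M is (just F) = matches M is F
matchLemma M is nothing  = false

module Check (adjacentPats nonadjacentPats : List Pat) (lemmas : List (List Bits)) where

  mayBeAdjacent : List Entry → List Bits → Ty → Ty → Bool
  mayBeAdjacent Es M a b = not (found M (proj₁ a) (proj₁ b) adjacentPats) ∧ consistent Es a b

  mayBeNonadjacent : List Bits → Ty → Ty → Bool
  mayBeNonadjacent M a b = not (found M (proj₁ a) (proj₁ b) nonadjacentPats)

  grow : List Entry → List Bits → Ty → List Ty → List Ty
  grow Es M t []      = []
  grow Es M t (a ∷ A) =
    add (mayBeNonadjacent M a t) (consᵗ false a)
      (add (mayBeAdjacent Es M a t) (consᵗ true a) (grow Es M t A))

  colours : List Ty → ℕ → List (Ty × ℕ)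
  colours []      c = []
  colours (a ∷ A) c = (a , c % 4) ∷ colours A (c / 4)

  compatible : List Entry → List Bits → Ty → ℕ → List (Ty × ℕ) → Bool
  compatible Es M a c []            = true
  compatible Es M a c ((b , d) ∷ L) = not ((c ≡ᵇ d) ∧ mayBeAdjacent Es M a b) ∧ compatible Es M a c L

  proper : List Entry → List Bits → List (Ty × ℕ) → Bool
  proper Es M []            = true
  -- A type is also tested against itself, because adjacent vertices may have the same type.
  proper Es M ((a , c) ∷ L) = compatible Es M a c ((a , c) ∷ L) ∧ proper Es M L

  check : List Entry → List Bits → List Ty → Tree → Bool
  checkWit : List Entry → List Bits → List Ty → Maybe Target → ℕ → List Tree → Bool
  checkAll : List Entry → List Bits → List Ty → List Ty → List Tree → Bool

  check Es M A (leaf c) = proper Es M (colours A c)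
  check Es M A (rem i s r) =
    check (real (at A i) ∷ Es) (extM (proj₁ (at A i)) M) (grow Es M (at A i) A) s ∧
    check Es M (remove (at A i) A) r
  check Es M A (ban i j s r) =
    let a = at A i ; b = at A j ; b′ = consᵗ true b
        Es′ = real a ∷ Es ; M′ = extM (proj₁ a) M
    in check (real b′ ∷ Es′) (extM (proj₁ b′) M′) (grow Es′ M′ b′ (grow Es M a A)) s ∧
       check (ban a b ∷ Es) M A r
  check Es M A (wit x j ts) = checkWit Es M A (target Es x j) x ts
  check Es M A (pseudo D S r) =
    check (pseudo (map (at A) D) (map (at A) S) ∷ Es) M (branch (map (at A) D) A) r
  check Es M A (cmp u v) = cmpRows (nth M u) (nth M v) ∧ allBits u v A
  check Es M A (lem l is) = matchLemma M is (nth lemmas l)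

  checkWit Es M A (just w) x ts = checkAll Es M A (hitting w x A) ts
  checkWit Es M A nothing  x ts = false

  checkAll Es M A []      []       = true
  checkAll Es M A (a ∷ L) (t ∷ ts) = check (real a ∷ Es) (extM (proj₁ a) M) (grow Es M a A) t ∧ checkAll Es M A L ts
  checkAll Es M A _       _        = false

  rootEntries : List Bits → List Entry
  rootEntries []       = []
  rootEntries (ds ∷ F) = real (ds , []) ∷ rootEntries F

  rootMatrix : List Bits → List Bits
  rootMatrix []       = []
  rootMatrix (ds ∷ F) = extM ds (rootMatrix F)

  rootTypes : List Bits → List Ty
  rootTypes []       = ([] , []) ∷ []
  rootTypes (ds ∷ F) = grow (rootEntries F) (rootMatrix F) (ds , []) (rootTypes F)

  refutes : List Bits → Tree → Bool
  refutes F = check (rootEntries F) (rootMatrix F) (rootTypes F)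

record Refutation (adjacentPats nonadjacentPats : List Pat) (lemmas : List (List Bits)) (F : List Bits) : Set where
  field
    tree  : Tree
    valid : Check.refutes adjacentPats nonadjacentPats lemmas F tree ≡ true


-- Soundness of the checker

∧-true : ∀ {a b} → a ∧ b ≡ true → a ≡ true × b ≡ true
∧-true {true} p = refl , p

∧-intro : ∀ {a b} → a ≡ true → b ≡ true → a ∧ b ≡ true
∧-intro refl p = p

∨-true : ∀ {a b} → a ∨ b ≡ true → a ≡ true ⊎ b ≡ true
∨-true {true}  p = inj₁ refl
∨-true {false} p = inj₂ p

not-true : ∀ {a} → (a ≡ true → ⊥) → not a ≡ true
not-true {true}  p = ⊥-elim (p refl)
not-true {false} p = refl

not-false : ∀ {a} → not a ≡ true → a ≡ true → ⊥
not-false {true} () _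

eqᵇ-sound : ∀ x y → eqᵇ x y ≡ true → x ≡ y
eqᵇ-sound true  true  _ = refl
eqᵇ-sound false false _ = refl

eqBits-sound : ∀ xs ys → eqBits xs ys ≡ true → xs ≡ ys
eqBits-sound []       []       _ = refl
eqBits-sound (x ∷ xs) (y ∷ ys) p with ∧-true {eqᵇ x y} p
... | q , r = cong₂ _∷_ (eqᵇ-sound x y q) (eqBits-sound xs ys r)

eqBits-refl : ∀ xs → eqBits xs xs ≡ true
eqBits-refl []           = refl
eqBits-refl (true ∷ xs)  = eqBits-refl xs
eqBits-refl (false ∷ xs) = eqBits-refl xs

eqTy-sound : ∀ a b → eqTy a b ≡ true → a ≡ b
eqTy-sound (a , as) (b , bs) p with ∧-true {eqBits a b} p
... | q , r = cong₂ _,_ (eqBits-sound a b q) (eqBits-sound as bs r)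

eqTy-refl : ∀ a → eqTy a a ≡ true
eqTy-refl (a , as) = ∧-intro (eqBits-refl a) (eqBits-refl as)

module _ {n : ℕ} (G : SimpleGraph n) where

  private
    V : Set
    V = Fin n

  row : List V → V → Bits
  row vs u = map (adj G u) vs

  some : (V → Bool) → Bool
  some p = does (any? (λ w → p w ≟ᵇ true))

  some-sound : ∀ p → some p ≡ true → ∃ λ w → p w ≡ true
  some-sound p e with any? (λ w → p w ≟ᵇ true)
  ... | yes q = q

  some-complete : ∀ p w → p w ≡ true → some p ≡ true
  some-complete p w e with any? (λ w → p w ≟ᵇ true)
  ... | yes _ = refl
  ... | no ¬q = ⊥-elim (¬q (w , e))

  ps : List Entry → List V → V → Bits
  ty : List Entry → List V → V → Ty

  ty Es vs u = row vs u , ps Es vs u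

  ps []                vs       u = []
  ps (real _ ∷ Es)     []       u = []
  ps (real _ ∷ Es)     (v ∷ vs) u = ps Es vs u
  ps (pseudo D S ∷ Es) vs       u =
    (elem (ty Es vs u) D ∧ some (λ w → adj G u w ∧ elem (ty Es vs w) S)) ∷ ps Es vs u
  ps (ban _ _ ∷ Es)    vs       u = ps Es vs u

  Valid : List Entry → List V → Set
  Valid []                []       = ⊤
  Valid []                (_ ∷ _)  = ⊥
  Valid (real t ∷ Es)     []       = ⊥
  Valid (real t ∷ Es)     (v ∷ vs) = ty Es vs v ≡ t × Valid Es vs
  Valid (pseudo D S ∷ Es) vs       = Valid Es vs
  Valid (ban s t ∷ Es)    vs       =
    (∀ x y → adj G x y ≡ true → ty Es vs x ≡ s → ty Es vs y ≡ t → ⊥) × Valid Es vs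

  Rel : V → Bits → List V → Set
  Rel w (d ∷ ds) (v ∷ vs) = adj G w v ≡ d × Rel w ds vs
  Rel w _        _        = ⊤

  PatCopy : Pat → V → V → List V → Set
  PatCopy []                     x y []       = ⊤
  PatCopy (((p , q) , ds) ∷ pat) x y (w ∷ ws) =
    adj G x w ≡ p × adj G y w ≡ q × Rel w ds ws × PatCopy pat x y ws
  PatCopy _                      x y _        = ⊥

  Copy : List Bits → List V → Set
  Copy []       []       = ⊤
  Copy (ds ∷ F) (w ∷ ws) = row ws w ≡ ds × Copy F ws
  Copy _        _        = ⊥

  Avoids : Bool → Pat → Set
  Avoids b pat = ∀ x y ws → adj G x y ≡ b → PatCopy pat x y ws → ⊥

  -- Minimality in the form that `cmp` uses: a colouring proper away from v stands for a colouring
  -- of the graph without v.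
  Critical : Set
  Critical = ∀ v → Σ (V → Fin 4) λ c → ∀ x y → x ≢ v → y ≢ v → adj G x y ≡ true → c x ≢ c y

  In : Bits → List V → V → Set
  In (b ∷ m) (v ∷ vs) w = (b ≡ true × v ≡ w) ⊎ In m vs w
  In _       _        w = ⊥

  In-mask : ∀ x y p q vs w → In (mask (row vs x) (row vs y) (p , q)) vs w → adj G x w ≡ p × adj G y w ≡ q
  In-mask x y p q (v ∷ vs) w (inj₁ (e , refl)) with ∧-true {eqᵇ (adj G x v) p} e
  ... | e₁ , e₂ = eqᵇ-sound _ _ e₁ , eqᵇ-sound _ _ e₂
  In-mask x y p q (v ∷ vs) w (inj₂ i) = In-mask x y p q vs w i

  In-refine : ∀ v d m vs w → In (zipWith (λ r c → c ∧ eqᵇ r d) (row vs v) m) vs w → adj G v w ≡ d × In m vs w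
  In-refine v d (c ∷ m) (u ∷ vs) w (inj₁ (e , refl)) with ∧-true {c} e
  ... | e₁ , e₂ = eqᵇ-sound _ _ e₂ , inj₁ (e₁ , refl)
  In-refine v d (c ∷ m) (u ∷ vs) w (inj₂ i) with In-refine v d m vs w i
  ... | e , j = e , inj₂ j

  -- The state of the search `find`: adjacencies to the vertices already placed are encoded in the
  -- masks, and `Sat-refine` reads them back.
  Sat : List V → List Bits → List Bits → List V → Set
  Sat vs []         ms       []       = ⊤
  Sat vs (ds ∷ dss) (m ∷ ms) (w ∷ ws) = In m vs w × Rel w ds ws × Sat vs dss ms ws
  Sat vs _          _        _        = ⊥

  Sat-refine : ∀ vs v ds dss ms ws → Sat vs dss (refine (row vs v) ds ms) ws → Rel v ds ws × Sat vs dss ms ws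
  Sat-refine vs v []       dss        ms       []       s = tt , s
  Sat-refine vs v []       dss        ms       (w ∷ ws) s = tt , s
  Sat-refine vs v (d ∷ ds) []         ms       []       s = tt , tt
  Sat-refine vs v (d ∷ ds) []         ms       (w ∷ ws) ()
  Sat-refine vs v (d ∷ ds) (es ∷ dss) []       (w ∷ ws) ()
  Sat-refine vs v (d ∷ ds) (es ∷ dss) []       []       ()
  Sat-refine vs v (d ∷ ds) (es ∷ dss) (m ∷ ms) []       ()
  Sat-refine vs v (d ∷ ds) (es ∷ dss) (m ∷ ms) (w ∷ ws) (i , r , s)
    with In-refine v d m vs w i | Sat-refine vs v ds dss ms ws s
  ... | e , j | r′ , s′ = (e , r′) , j , r , s′

  anyRow-sound : ∀ vs us m p → anyRow (map (row vs) us) m p ≡ true → ∃ λ v → In m us v × p (row vs v) ≡ true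
  anyRow-sound vs (u ∷ us) (b ∷ m) p e with ∨-true {b ∧ p (row vs u)} e
  ... | inj₁ e′ with ∧-true {b} e′
  ...   | e₁ , e₂ = u , inj₁ (e₁ , refl) , e₂
  anyRow-sound vs (u ∷ us) (b ∷ m) p e | inj₂ e′ with anyRow-sound vs us m p e′
  ... | v , i , q = v , inj₂ i , q

  matrix : List V → List Bits
  matrix vs = map (row vs) vs

  find-sound : ∀ vs dss ms → find (matrix vs) dss ms ≡ true → ∃ λ ws → Sat vs dss ms ws
  find-sound vs []         ms       e = [] , tt
  find-sound vs (ds ∷ dss) (m ∷ ms) e with anyRow-sound vs vs m _ e
  ... | v , i , e′ with find-sound vs dss (refine (row vs v) ds ms) e′
  ... | ws , s with Sat-refine vs v ds dss ms ws s
  ... | r , s′ = v ∷ ws , i , r , s′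

  Sat⇒PatCopy : ∀ vs x y pat ws →
    Sat vs (map proj₂ pat) (map (λ v → mask (row vs x) (row vs y) (proj₁ v)) pat) ws → PatCopy pat x y ws
  Sat⇒PatCopy vs x y []                     []       s           = tt
  Sat⇒PatCopy vs x y (((p , q) , ds) ∷ pat) (w ∷ ws) (i , r , s) with In-mask x y p q vs w i
  ... | e₁ , e₂ = e₁ , e₂ , r , Sat⇒PatCopy vs x y pat ws s

  found-sound : ∀ {b} vs x y pats → All (Avoids b) pats → adj G x y ≡ b →
                found (matrix vs) (row vs x) (row vs y) pats ≡ true → ⊥
  found-sound vs x y (pat ∷ pats) (h ∷ hs) a e
    with ∨-true {find (matrix vs) (map proj₂ pat) (map (λ v → mask (row vs x) (row vs y) (proj₁ v)) pat)} e
  ... | inj₂ e′ = found-sound vs x y pats hs a e′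
  ... | inj₁ e′ with find-sound vs (map proj₂ pat) _ e′
  ... | ws , s = h x y ws a (Sat⇒PatCopy vs x y pat ws s)

  extM-matrix : ∀ v vs → extM (row vs v) (matrix vs) ≡ matrix (v ∷ vs)
  extM-matrix v vs = cong₂ _∷_ (cong (_∷ row vs v) (sym (irrefl G v))) (go vs)
    where
    go : ∀ us → zipWith _∷_ (row us v) (map (row vs) us) ≡ map (row (v ∷ vs)) us
    go []       = refl
    go (u ∷ us) = cong₂ _∷_ (cong (_∷ row vs u) (adj-sym G v u)) (go us)

  consistent-sound : ∀ Es vs x y → Valid Es vs → adj G x y ≡ true →
                     consistent Es (ty Es vs x) (ty Es vs y) ≡ true
  consistent-sound []                vs       x y ok a = refl
  consistent-sound (real t ∷ Es)     (v ∷ vs) x y (_ , ok) a = consistent-sound Es vs x y ok a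
  consistent-sound (pseudo D S ∷ Es) vs       x y ok a =
    ∧-intro (half x y a) (∧-intro (half y x (trans (adj-sym G y x) a)) (consistent-sound Es vs x y ok a))
    where
    half : ∀ x y → adj G x y ≡ true →
      not (elem (ty Es vs x) S ∧ elem (ty Es vs y) D ∧
           not (elem (ty Es vs y) D ∧ some (λ w → adj G y w ∧ elem (ty Es vs w) S))) ≡ true
    half x y a = not-true λ e →
      let e₁ , e₂₃ = ∧-true {elem (ty Es vs x) S} e
          e₂ , e₃ = ∧-true {elem (ty Es vs y) D} e₂₃
      in not-false e₃ (∧-intro e₂ (some-complete _ x (∧-intro (trans (adj-sym G y x) a) e₁)))
  consistent-sound (ban s t ∷ Es) vs x y (no-st , ok) a =
    ∧-intro (not-true λ e → let e₁ , e₂ = ∧-true {eqTy (ty Es vs x) s} e in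
                             no-st x y a (eqTy-sound _ _ e₁) (eqTy-sound _ _ e₂))
      (∧-intro (not-true λ e → let e₁ , e₂ = ∧-true {eqTy (ty Es vs x) t} e in
                                no-st y x (trans (adj-sym G y x) a) (eqTy-sound _ _ e₂) (eqTy-sound _ _ e₁))
        (consistent-sound Es vs x y ok a))

  add-there : ∀ {a b : Ty} {A} c → a ∈ A → a ∈ add c b A
  add-there true  i = there i
  add-there false i = i

  add-here : ∀ {a : Ty} {A} c → c ≡ true → a ∈ add c a A
  add-here true _ = here refl

  remove-∈ : ∀ {a t} A → a ∈ A → (eqTy a t ≡ true → ⊥) → a ∈ remove t A
  remove-∈ (a ∷ A) (here refl) ne = add-here _ (not-true ne)
  remove-∈ (b ∷ A) (there i)   ne = add-there _ (remove-∈ A i ne)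

  branch-∈ : ∀ {a as} D c A → (a , as) ∈ A → (a , (elem (a , as) D ∧ c) ∷ as) ∈ branch D A
  branch-∈ {a} {as} D c (_ ∷ A) (here refl) with elem (a , as) D | c
  ... | false | _     = here refl
  ... | true  | false = here refl
  ... | true  | true  = there (here refl)
  branch-∈ D c (_ ∷ A) (there i) = there (add-there _ (branch-∈ D c A i))

  hitting-∈ : ∀ {a} w x A → a ∈ A → hits w x a ≡ true → a ∈ hitting w x A
  hitting-∈ w x (a ∷ A) (here refl) h = add-here _ h
  hitting-∈ w x (b ∷ A) (there i)   h = add-there _ (hitting-∈ w x A i h)

  Reached : List Entry → List V → Target → V → Set
  Reached Es vs (S , i , j) w = elem (drop i (row vs w) , drop j (ps Es vs w)) S ≡ true

  targetBelow-sound : ∀ Es vs v j τ → Valid Es vs → targetBelow Es (ps Es vs v) j ≡ just τ →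
                      ∃ λ w → adj G w v ≡ true × Reached Es vs τ w
  targetBelow-sound (real _ ∷ Es) (u ∷ vs) v j τ (_ , ok) e
    with targetBelow Es (ps Es vs v) j in eq
  targetBelow-sound (real _ ∷ Es) (u ∷ vs) v j τ (_ , ok) refl | just τ′ =
    targetBelow-sound Es vs v j τ′ ok eq
  targetBelow-sound (pseudo D S ∷ Es) vs v zero τ ok e
    with elem (ty Es vs v) D ∧ some (λ w → adj G v w ∧ elem (ty Es vs w) S) in eq
  targetBelow-sound (pseudo D S ∷ Es) vs v zero τ ok refl | true
    with some-sound _ (proj₂ (∧-true {elem (ty Es vs v) D} eq))
  ... | w , e with ∧-true {adj G v w} e
  ... | e₁ , e₂ = w , trans (adj-sym G w v) e₁ , e₂
  targetBelow-sound (pseudo D S ∷ Es) vs v (suc j) τ ok e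
    with targetBelow Es (ps Es vs v) j in eq
  targetBelow-sound (pseudo D S ∷ Es) vs v (suc j) τ ok refl | just τ′ = targetBelow-sound Es vs v j τ′ ok eq
  targetBelow-sound (ban _ _ ∷ Es) vs v j τ (_ , ok) e = targetBelow-sound Es vs v j τ ok e

  target-sound : ∀ Es vs x j τ → Valid Es vs → target Es x j ≡ just τ →
                 ∃ λ w → bitAt (row vs w) x ≡ true × Reached Es vs τ w
  target-sound (real _ ∷ Es) (v ∷ vs) zero j τ (refl , ok) e
    with targetBelow Es (ps Es vs v) j in eq
  target-sound (real _ ∷ Es) (v ∷ vs) zero j τ (refl , ok) refl | just τ′ = targetBelow-sound Es vs v j τ′ ok eq
  target-sound (real _ ∷ Es) (v ∷ vs) (suc x) j τ (_ , ok) e with target Es x j in eq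
  target-sound (real _ ∷ Es) (v ∷ vs) (suc x) j τ (_ , ok) refl | just τ′ = target-sound Es vs x j τ′ ok eq
  target-sound (pseudo D S ∷ Es) vs x (suc j) τ ok e with target Es x j in eq
  target-sound (pseudo D S ∷ Es) vs x (suc j) τ ok refl | just τ′ = target-sound Es vs x j τ′ ok eq
  target-sound (ban _ _ ∷ Es) vs x j τ (_ , ok) e = target-sound Es vs x j τ ok e

  nth-map : ∀ {B : Set} (h : V → B) vs i {b} → nth (map h vs) i ≡ just b → ∃ λ v → nth vs i ≡ just v × h v ≡ b
  nth-map h (v ∷ vs) zero    refl = v , refl , refl
  nth-map h (v ∷ vs) (suc i) e    = nth-map h vs i e

  bitAt-row : ∀ u vs i v → nth vs i ≡ just v → bitAt (row vs u) i ≡ adj G u v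
  bitAt-row u (v ∷ vs) zero    _ refl = refl
  bitAt-row u (_ ∷ vs) (suc i) v e    = bitAt-row u vs i v e

  allBits-sound : ∀ u v A {a} → allBits u v A ≡ true → a ∈ A → bitAt (proj₁ a) u ≡ true → bitAt (proj₁ a) v ≡ true
  allBits-sound u v ((a , _) ∷ A) e (here refl) p with ∧-true {not (bitAt a u) ∨ bitAt a v} e
  ... | e₁ , _ with ∨-true {not (bitAt a u)} e₁
  ... | inj₁ q = ⊥-elim (not-false q p)
  ... | inj₂ q = q
  allBits-sound u v ((a , _) ∷ A) e (there i) p =
    allBits-sound u v A (proj₂ (∧-true {not (bitAt a u) ∨ bitAt a v} e)) i p

  matchRow-sound : ∀ vs u is ds → matchRow (row vs u) is ds ≡ true →
                   (ws : List V) → map just ws ≡ map (nth vs) is → row ws u ≡ ds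
  matchRow-sound vs u []       []       e []       q = refl
  matchRow-sound vs u (i ∷ is) (d ∷ ds) e (w ∷ ws) q with ∧-true {eqᵇ (bitAt (row vs u) i) d} e
  ... | e₁ , e₂ = cong₂ _∷_ (trans (sym (bitAt-row u vs i w (sym (proj₁ (∷-injective q))))) (eqᵇ-sound _ _ e₁))
                    (matchRow-sound vs u is ds e₂ ws (proj₂ (∷-injective q)))

  matches-sound : ∀ vs is F → matches (matrix vs) is F ≡ true →
                  ∃ λ ws → map just ws ≡ map (nth vs) is × Copy F ws
  matches-sound vs []       []       e = [] , refl , tt
  matches-sound vs (i ∷ is) (ds ∷ F) e with nth (matrix vs) i in eq
  ... | just r with ∧-true {matchRow r is ds} e
  ... | e₁ , e₂ with nth-map (row vs) vs i eq | matches-sound vs is F e₂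
  ... | v , p , refl | ws , q , c =
    v ∷ ws , cong₂ _∷_ (sym p) q , matchRow-sound vs v is ds e₁ ws q , c

  module Soundness (aPats nPats : List Pat) (lemmas : List (List Bits))
    (aOK : All (Avoids true) aPats) (nOK : All (Avoids false) nPats)
    (crit : Critical) (lemOK : All (λ F → ∀ ws → Copy F ws → Colourable G 4) lemmas) where

    open Check aPats nPats lemmas

    mayBeAdjacent-sound : ∀ Es vs x y → Valid Es vs → adj G x y ≡ true →
                          mayBeAdjacent Es (matrix vs) (ty Es vs x) (ty Es vs y) ≡ true
    mayBeAdjacent-sound Es vs x y ok a =
      ∧-intro (not-true (found-sound vs x y aPats aOK a)) (consistent-sound Es vs x y ok a)

    grow-false : ∀ Es M t A {a} → a ∈ A → mayBeNonadjacent M a t ≡ true → consᵗ false a ∈ grow Es M t A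
    grow-false Es M t (a ∷ A) (here refl) e = add-here _ e
    grow-false Es M t (b ∷ A) (there i)   e =
      add-there (mayBeNonadjacent M b t) (add-there (mayBeAdjacent Es M b t) (grow-false Es M t A i e))

    grow-true : ∀ Es M t A {a} → a ∈ A → mayBeAdjacent Es M a t ≡ true → consᵗ true a ∈ grow Es M t A
    grow-true Es M t (a ∷ A) (here refl) e = add-there (mayBeNonadjacent M a t) (add-here _ e)
    grow-true Es M t (b ∷ A) (there i)   e =
      add-there (mayBeNonadjacent M b t) (add-there (mayBeAdjacent Es M b t) (grow-true Es M t A i e))

    Covers : List Entry → List V → List Ty → Set
    Covers Es vs A = ∀ u → ty Es vs u ∈ A

    grow-covers : ∀ Es vs A v → Valid Es vs → Covers Es vs A →
                  Covers (real (ty Es vs v) ∷ Es) (v ∷ vs) (grow Es (matrix vs) (ty Es vs v) A)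
    grow-covers Es vs A v ok cov u with adj G u v in eq
    ... | true  = grow-true Es (matrix vs) _ A (cov u) (mayBeAdjacent-sound Es vs u v ok eq)
    ... | false = grow-false Es (matrix vs) _ A (cov u) (not-true (found-sound vs u v nPats nOK eq))

    colourOf : List (Ty × ℕ) → Ty → ℕ
    colourOf []            t = 0
    colourOf ((a , c) ∷ L) t = if eqTy t a then c else colourOf L t

    colourOf<4 : ∀ A c t → colourOf (colours A c) t < 4
    colourOf<4 []      c t = z<s
    colourOf<4 (a ∷ A) c t with eqTy t a
    ... | true  = m%n<n c 4
    ... | false = colourOf<4 A (c / 4) t

    keys : ∀ {a} A c → a ∈ A → a ∈ map proj₁ (colours A c)
    keys (a ∷ A) c (here e)  = here e
    keys (a ∷ A) c (there i) = there (keys A (c / 4) i)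

    compatible-sound : ∀ Es M a c L {b} → compatible Es M a c L ≡ true → b ∈ map proj₁ L →
                       c ≡ colourOf L b → mayBeAdjacent Es M a b ≡ true → ⊥
    compatible-sound Es M a c ((h , d) ∷ L) {b} e i eq m with ∧-true {not ((c ≡ᵇ d) ∧ mayBeAdjacent Es M a h)} e
    ... | e₁ , e₂ with eqTy b h in q
    ... | true  = not-false e₁ (∧-intro (Equivalence.to T-≡ (≡⇒≡ᵇ c d eq))
                                 (subst (λ z → mayBeAdjacent Es M a z ≡ true) (eqTy-sound b h q) m))
    ... | false with i
    ...   | there i′  = compatible-sound Es M a c L e₂ i′ eq m
    ...   | here refl with trans (sym q) (eqTy-refl b)
    ...     | ()

    -- The checker tests a pair only in the order in which the list meets it, and `mayBeAdjacent` is
    -- not shown to be symmetric; hence the assumption in both orders.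
    proper-sound : ∀ Es M L {a b} → proper Es M L ≡ true → a ∈ map proj₁ L → b ∈ map proj₁ L →
                   mayBeAdjacent Es M a b ≡ true → mayBeAdjacent Es M b a ≡ true → colourOf L a ≢ colourOf L b
    proper-sound Es M ((h , d) ∷ L) {a} {b} e i j ab ba eq with ∧-true {compatible Es M h d ((h , d) ∷ L)} e
    ... | e₁ , e₂ with eqTy a h in p
    proper-sound Es M ((h , d) ∷ L) {a} {b} e i j ab ba eq | e₁ , e₂ | true =
      compatible-sound Es M h d ((h , d) ∷ L) e₁ j eq
        (subst (λ z → mayBeAdjacent Es M z b ≡ true) (eqTy-sound a h p) ab)
    ... | false with eqTy b h in q
    proper-sound Es M ((h , d) ∷ L) {a} {b} e i j ab ba eq | e₁ , e₂ | false | true =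
      compatible-sound Es M h d ((h , d) ∷ L) {a} e₁ i (lhs p)
        (subst (λ z → mayBeAdjacent Es M z a ≡ true) (eqTy-sound b h q) ba)
      where
      lhs : eqTy a h ≡ false → d ≡ colourOf ((h , d) ∷ L) a
      lhs r rewrite r = sym eq
    proper-sound Es M ((h , d) ∷ L) {a} {b} e i j ab ba eq | e₁ , e₂ | false | false with i | j
    ... | there i′ | there j′ = proper-sound Es M L e₂ i′ j′ ab ba eq
    ... | here refl | _ with trans (sym p) (eqTy-refl a)
    ...   | ()
    proper-sound Es M ((h , d) ∷ L) {a} {b} e i j ab ba eq | e₁ , e₂ | false | false | there _ | here refl
      with trans (sym q) (eqTy-refl b)
    ... | ()

    lemma-sound : ∀ vs is l Ls → All (λ F → ∀ ws → Copy F ws → Colourable G 4) Ls →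
                  matchLemma (matrix vs) is (nth Ls l) ≡ true → Colourable G 4
    lemma-sound vs is zero    (F ∷ Ls) (h ∷ _)  e with matches-sound vs is F e
    ... | ws , _ , c = h ws c
    lemma-sound vs is (suc l) (F ∷ Ls) (_ ∷ hs) e = lemma-sound vs is l Ls hs e

    dominated⇒colourable : ∀ u v → u ≢ v → (∀ w → adj G w u ≡ true → adj G w v ≡ true) → Colourable G 4
    dominated⇒colourable u v u≢v dom = c′ , proper′
      where
      c = proj₁ (crit u)
      c-proper = proj₂ (crit u)
      c′ : V → Fin 4
      c′ x with x ≟ᶠ u
      ... | yes _ = c v
      ... | no  _ = c x
      proper′ : ∀ x y → adj G x y ≡ true → c′ x ≢ c′ y
      proper′ x y a with x ≟ᶠ u | y ≟ᶠ u
      ... | no x≢  | no y≢  = c-proper x y x≢ y≢ a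
      ... | yes refl | yes refl with trans (sym a) (irrefl G x)
      ...   | ()
      proper′ x y a | yes refl | no y≢ =
        c-proper v y (u≢v ∘ sym) y≢ (trans (adj-sym G v y) (dom y (trans (adj-sym G y x) a)))
      proper′ x y a | no x≢ | yes refl = c-proper x v x≢ (u≢v ∘ sym) (dom x a)

    -- Every end of a tree yields a colouring instead of a contradiction: `leaf` from the types,
    -- `cmp` from the graph without the dominated vertex, `lem` from an earlier refutation. The
    -- invariant `Covers` makes the listed types exhaustive, so that a `leaf` colours every vertex.
    sound : ∀ Es A vs tr → check Es (matrix vs) A tr ≡ true → Valid Es vs → Covers Es vs A → Colourable G 4
    sound-all : ∀ Es A vs L trs w → checkAll Es (matrix vs) A L trs ≡ true → Valid Es vs → Covers Es vs A →
                ty Es vs w ∈ L → Colourable G 4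

    sound-real : ∀ Es A vs tr v {t} → ty Es vs v ≡ t →
      check (real t ∷ Es) (extM (proj₁ t) (matrix vs)) (grow Es (matrix vs) t A) tr ≡ true →
      Valid Es vs → Covers Es vs A → Colourable G 4
    sound-real Es A vs tr v refl e ok cov rewrite extM-matrix v vs =
      sound _ _ (v ∷ vs) tr e (refl , ok) (grow-covers Es vs A v ok cov)

    sound Es A vs (leaf c) e ok cov = col , col-proper
      where
      L = colours A c
      col : V → Fin 4
      col u = fromℕ< (colourOf<4 A c (ty Es vs u))
      col-proper : ∀ x y → adj G x y ≡ true → col x ≢ col y
      col-proper x y a eq =
        proper-sound Es (matrix vs) L e (keys A c (cov x)) (keys A c (cov y))
          (mayBeAdjacent-sound Es vs x y ok a)
          (mayBeAdjacent-sound Es vs y x ok (trans (adj-sym G y x) a))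
          (fromℕ<-injective _ _ (colourOf<4 A c (ty Es vs x)) (colourOf<4 A c (ty Es vs y)) eq)
    sound Es A vs (rem i s r) e ok cov
      with ∧-true {check (real (at A i) ∷ Es) (extM (proj₁ (at A i)) (matrix vs)) (grow Es (matrix vs) (at A i) A) s} e
         | any? (λ u → eqTy (ty Es vs u) (at A i) ≟ᵇ true)
    ... | e₁ , e₂ | yes (u , q) = sound-real Es A vs s u (eqTy-sound _ _ q) e₁ ok cov
    ... | e₁ , e₂ | no ¬q       = sound Es (remove (at A i) A) vs r e₂ ok λ u → remove-∈ A (cov u) λ q → ¬q (u , q)
    sound Es A vs (ban i j s r) e ok cov
      with ∧-true {check (real (consᵗ true (at A j)) ∷ real (at A i) ∷ Es)
                     (extM (proj₁ (consᵗ true (at A j))) (extM (proj₁ (at A i)) (matrix vs)))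
                     (grow (real (at A i) ∷ Es) (extM (proj₁ (at A i)) (matrix vs)) (consᵗ true (at A j))
                       (grow Es (matrix vs) (at A i) A)) s} e
         | any? (λ x → any? (λ y → (adj G x y ∧ eqTy (ty Es vs x) (at A i) ∧ eqTy (ty Es vs y) (at A j)) ≟ᵇ true))
    ... | e₁ , e₂ | no ¬q = sound (ban (at A i) (at A j) ∷ Es) A vs r e₂
      ((λ x y a p q → ¬q (x , y , ∧-intro a (∧-intro (trans (cong (λ z → eqTy z (at A i)) p) (eqTy-refl (at A i)))
                                                      (trans (cong (λ z → eqTy z (at A j)) q) (eqTy-refl (at A j)))))) , ok) cov
    ... | e₁ , e₂ | yes (x , y , q) with ∧-true {adj G x y} q
    ... | a , q′ with ∧-true {eqTy (ty Es vs x) (at A i)} q′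
    ... | q₁ , q₂ = pair (eqTy-sound _ _ q₁) (eqTy-sound _ _ q₂) e₁
      where
      pair : ∀ {t t′} → ty Es vs x ≡ t → ty Es vs y ≡ t′ →
             check (real (consᵗ true t′) ∷ real t ∷ Es)
                     (extM (proj₁ (consᵗ true t′)) (extM (proj₁ t) (matrix vs)))
                     (grow (real t ∷ Es) (extM (proj₁ t) (matrix vs)) (consᵗ true t′)
                       (grow Es (matrix vs) t A)) s ≡ true → Colourable G 4
      pair refl refl e₁ =
        sound-real (real (ty Es vs x) ∷ Es) _ (x ∷ vs) s y
          (cong (λ z → z ∷ row vs y , ps Es vs y) (trans (adj-sym G y x) a))
          (subst (λ M → check (real (consᵗ true (ty Es vs y)) ∷ real (ty Es vs x) ∷ Es) (extM (true ∷ row vs y) M)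
                          (grow (real (ty Es vs x) ∷ Es) M (consᵗ true (ty Es vs y)) (grow Es (matrix vs) (ty Es vs x) A))
                          s ≡ true) (extM-matrix x vs) e₁)
          (refl , ok) (grow-covers Es vs A x ok cov)
    sound Es A vs (wit x j ts) e ok cov with target Es x j in eq
    ... | just τ with target-sound Es vs x j τ ok eq
    ... | w , b , r = sound-all Es A vs (hitting τ x A) ts w e ok cov (hitting-∈ τ x A (cov w) (∧-intro b r))
    sound Es A vs (pseudo D S r) e ok cov =
      sound (pseudo (map (at A) D) (map (at A) S) ∷ Es) _ vs r e ok λ u → branch-∈ (map (at A) D) _ A (cov u)
    sound Es A vs (cmp u v) e ok cov with nth (matrix vs) u in eu | nth (matrix vs) v in ev
    ... | just ru | just rv with ∧-true {not (eqBits ru rv)} e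
    ... | e₁ , e₂ with nth-map (row vs) vs u eu | nth-map (row vs) vs v ev
    ... | x , px , refl | y , py , refl =
      dominated⇒colourable x y
        (λ where refl → not-false e₁ (eqBits-refl (row vs x)))
        (λ w a → trans (sym (bitAt-row w vs v y py))
                   (allBits-sound u v A e₂ (cov w) (trans (bitAt-row w vs u x px) a)))
    sound Es A vs (lem l is) e ok cov = lemma-sound vs is l lemmas lemOK e

    sound-all Es A vs (t ∷ L) (tr ∷ trs) w e ok cov i
      with ∧-true {check (real t ∷ Es) (extM (proj₁ t) (matrix vs)) (grow Es (matrix vs) t A) tr} e
    sound-all Es A vs (t ∷ L) (tr ∷ trs) w e ok cov (here p)  | e₁ , e₂ = sound-real Es A vs tr w p e₁ ok cov
    sound-all Es A vs (t ∷ L) (tr ∷ trs) w e ok cov (there i) | e₁ , e₂ = sound-all Es A vs L trs w e₂ ok cov i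

    root-valid : ∀ F ws → Copy F ws → Valid (rootEntries F) ws
    root-ps : ∀ F ws u → ps (rootEntries F) ws u ≡ []
    root-ps []       ws       u = refl
    root-ps (_ ∷ F)  []       u = refl
    root-ps (_ ∷ F)  (w ∷ ws) u = root-ps F ws u
    root-valid []       []       c       = tt
    root-valid (ds ∷ F) (w ∷ ws) (e , c) = cong₂ _,_ e (root-ps F ws w) , root-valid F ws c

    root-matrix : ∀ F ws → Copy F ws → rootMatrix F ≡ matrix ws
    root-matrix []       []       c          = refl
    root-matrix (ds ∷ F) (w ∷ ws) (refl , c) =
      trans (cong (extM ds) (root-matrix F ws c)) (extM-matrix w ws)

    root-covers : ∀ F ws → Copy F ws → Covers (rootEntries F) ws (rootTypes F)
    root-covers []       []       c       u = here refl
    root-covers (ds ∷ F) (w ∷ ws) (e , c) u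
      rewrite root-matrix F ws c | sym e | sym (root-ps F ws w) =
        subst (λ z → ty (real (row ws w , z) ∷ rootEntries F) (w ∷ ws) u ∈
                     grow (rootEntries F) (matrix ws) (row ws w , z) (rootTypes F)) refl
          (grow-covers (rootEntries F) ws (rootTypes F) w (root-valid F ws c) (root-covers F ws c) u)

    refutation-sound : ∀ {F} → Refutation aPats nPats lemmas F → ∀ ws → Copy F ws → Colourable G 4
    refutation-sound {F} r ws c =
      sound (rootEntries F) (rootTypes F) ws tree
        (subst (λ M → check (rootEntries F) M (rootTypes F) tree ≡ true) (root-matrix F ws c) valid)
        (root-valid F ws c) (root-covers F ws c)
      where open Refutation r

-- The two classes: forbidden patterns and refutations

private
  pattern I = true
  pattern O = false

-- Each forbidden graph occurs once for every position of the pair x, y in it, up to symmetry. In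
-- 2K₂ and 3K₂ an adjacent pair is an edge and a nonadjacent pair consists of ends of two edges; in
-- K₃ and K₄ all pairs are adjacent.
2K₂K₄-adjacent 2K₂K₄-nonadjacent 3K₂K₃-adjacent 3K₂K₃-nonadjacent : List Pat
2K₂K₄-adjacent =
  (((O , O) , I ∷ []) ∷ ((O , O) , []) ∷ []) ∷
  (((I , I) , I ∷ []) ∷ ((I , I) , []) ∷ []) ∷ []
2K₂K₄-nonadjacent =
  (((I , O) , O ∷ []) ∷ ((O , I) , []) ∷ []) ∷ []
3K₂K₃-adjacent =
  (((I , I) , []) ∷ []) ∷
  (((O , O) , I ∷ O ∷ O ∷ []) ∷ ((O , O) , O ∷ O ∷ []) ∷ ((O , O) , I ∷ []) ∷ ((O , O) , []) ∷ []) ∷ []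
3K₂K₃-nonadjacent =
  (((I , O) , O ∷ O ∷ O ∷ []) ∷ ((O , I) , O ∷ O ∷ []) ∷ ((O , O) , I ∷ []) ∷ ((O , O) , []) ∷ []) ∷ []

-- A pentagon, and a pentagon with one further vertex that has 5, 4 or 3 neighbours on it; in the case of 3, two of
-- them consecutive, possibly with another vertex that has no neighbour on the pentagon and is nonadjacent (C₅³⁰) or
-- adjacent (C₅³¹) to the first.
C₅ C₅⁵ C₅⁴ C₅³ C₅³⁰ C₅³¹ K₃ : List Bits
C₅ = (I ∷ O ∷ O ∷ I ∷ []) ∷ (I ∷ O ∷ O ∷ []) ∷ (I ∷ O ∷ []) ∷ (I ∷ []) ∷ [] ∷ []
C₅⁵ = (I ∷ I ∷ I ∷ I ∷ I ∷ []) ∷ (I ∷ O ∷ O ∷ I ∷ []) ∷ (I ∷ O ∷ O ∷ []) ∷ (I ∷ O ∷ []) ∷ (I ∷ []) ∷ [] ∷ []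
C₅⁴ = (O ∷ I ∷ I ∷ I ∷ I ∷ []) ∷ (I ∷ O ∷ O ∷ I ∷ []) ∷ (I ∷ O ∷ O ∷ []) ∷ (I ∷ O ∷ []) ∷ (I ∷ []) ∷ [] ∷ []
C₅³ = (O ∷ I ∷ I ∷ O ∷ I ∷ []) ∷ (I ∷ O ∷ O ∷ I ∷ []) ∷ (I ∷ O ∷ O ∷ []) ∷ (I ∷ O ∷ []) ∷ (I ∷ []) ∷ [] ∷ []
C₅³⁰ = (O ∷ O ∷ O ∷ O ∷ O ∷ O ∷ []) ∷ (O ∷ I ∷ I ∷ O ∷ I ∷ []) ∷ (I ∷ O ∷ O ∷ I ∷ []) ∷ (I ∷ O ∷ O ∷ []) ∷ (I ∷ O ∷ [])
        ∷ (I ∷ []) ∷ [] ∷ []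
C₅³¹ = (I ∷ O ∷ O ∷ O ∷ O ∷ O ∷ []) ∷ (O ∷ I ∷ I ∷ O ∷ I ∷ []) ∷ (I ∷ O ∷ O ∷ I ∷ []) ∷ (I ∷ O ∷ O ∷ []) ∷ (I ∷ O ∷ [])
        ∷ (I ∷ []) ∷ [] ∷ []
K₃ = (I ∷ I ∷ []) ∷ (I ∷ []) ∷ [] ∷ []

-- The refutations were found by computer search.
C₅⁵-refutation : Refutation 2K₂K₄-adjacent 2K₂K₄-nonadjacent [] C₅⁵
C₅⁵-refutation = record
  { tree =
    ban 2 5 (ban 4 17 (cmp 6 1) (ban 18 16 (cmp 8 0) (ban 20 12 (leaf 3310418859) (ban 20 19 (leaf 580255736) (ban
    22 11 (cmp 3 0) (ban 5 19 (cmp 9 2) (ban 10 19 (cmp 9 2) (ban 2 7 (cmp 9 2) (ban 20 13 (leaf 366531805226) (ban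
    8 21 (leaf 750614243969361) (ban 3 15 (cmp 8 0) (ban 17 24 (cmp 3 1) (ban 20 16 (leaf 21776631974) (ban 2 16
    (cmp 9 2) (ban 5 16 (leaf 45101339999) (ban 6 16 (leaf 23438233231216531451) (ban 7 16 (leaf 38609336492485308)
    (leaf 17997826981909909)))))))))))))))))) (ban 8 5 (ban 16 18 (leaf 9310506324) (ban 8 22 (leaf 24184250302464)
    (ban 23 22 (leaf 383332564990) (ban 10 15 (cmp 9 2) (ban 25 12 (leaf 356242035482763) (ban 4 3 (cmp 9 2) (ban 20
    19 (leaf 34449305598) (ban 7 17 (cmp 9 2) (ban 25 8 (cmp 0 3) (leaf 12003712750993405)))))))))) (ban 9 5 (ban 17
    14 (leaf 366819696625) (ban 24 19 (leaf 1476039606514) (ban 6 10 (cmp 9 2) (ban 16 13 (cmp 9 2) (ban 9 19 (cmp 9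
    2) (ban 16 25 (leaf 375380847357998) (ban 7 22 (leaf 1087991098538) (ban 11 20 (cmp 9 2) (ban 12 20 (leaf
    1530563977619350025) (ban 23 20 (cmp 9 2) (leaf 4437454443416229))))))))))) (ban 10 5 (ban 10 23 (leaf
    2943562608885) (ban 9 8 (cmp 9 2) (leaf 568895241975786))) (ban 11 7 (ban 13 14 (leaf 18014215174275746) (ban 13
    18 (cmp 5 1) (ban 13 21 (leaf 1125876641830056) (ban 8 22 (leaf 55773088416) (ban 17 7 (cmp 7 2) (ban 20 19 (cmp
    7 2) (ban 24 17 (cmp 7 2) (ban 8 2 (leaf 206893555561) (ban 11 6 (cmp 7 2) (ban 15 23 (leaf 374940579001324)
    (ban 26 12 (leaf 2933426508801) (ban 10 21 (cmp 3 0) (ban 20 17 (cmp 7 2) (ban 21 17 (leaf 365197721473) (ban 10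
    14 (leaf 91539106618) (ban 10 15 (leaf 17590705475750) (ban 10 16 (leaf 5634106894) (leaf
    140748978995037)))))))))))))))))) (ban 6 12 (ban 8 9 (cmp 7 1) (ban 10 2 (leaf 4559105163179) (ban 11 17 (leaf
    246261949464744) (ban 16 24 (leaf 21810194849) (ban 8 3 (leaf 1501206836674735) (ban 16 2 (leaf 1064281036458)
    (ban 11 2 (leaf 71764759134876005) (ban 8 21 (leaf 750588549657927) (leaf 18003401933934664))))))))) (ban 13 3
    (ban 14 4 (cmp 6 2) (ban 17 24 (cmp 6 2) (ban 26 15 (leaf 2931321438005) (ban 17 21 (cmp 6 2) (ban 21 18 (leaf
    102599481851918) (ban 21 20 (cmp 6 2) (ban 7 6 (leaf 4397445317207) (ban 3 10 (leaf 2930782440789) (ban 21 9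
    (cmp 6 2) (ban 14 25 (cmp 6 2) (leaf 12027186815692804))))))))))) (ban 18 15 (ban 15 6 (cmp 6 0) (ban 27 21
    (leaf 2795777578975) (ban 7 29 (cmp 3 0) (ban 30 21 (leaf 52387729424738) (ban 14 21 (leaf 1409526521) (ban 28
    14 (leaf 2933350549717) (ban 29 14 (cmp 3 1) (ban 1 16 (cmp 1 7) (ban 15 1 (leaf 22884577210) (ban 15 3 (leaf
    91636638700) (ban 26 12 (cmp 7 0) (ban 26 13 (leaf 713923380424572) (leaf 3066960240671965180))))))))))))) (ban
    18 17 (ban 17 5 (leaf 1140696745) (leaf 4430304729105492)) (ban 16 19 (ban 11 6 (leaf 370834472189920) (ban 1 14
    (cmp 1 5) (ban 7 17 (leaf 68338647174) (leaf 12070493938374005)))) (ban 16 20 (ban 7 11 (leaf 728734367766) (ban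
    25 7 (cmp 0 9) (ban 24 16 (cmp 5 0) (leaf 913298043513450)))) (ban 21 15 (ban 9 19 (leaf 17022583130) (ban 19 10
    (leaf 134130008) (leaf 1506468767726273))) (leaf 23456624210056))))))))))))
  ; valid = refl
  }

-- A copy of a graph refuted earlier closes a branch through `lem`. Thus, after C₅⁵, a vertex
-- adjacent to a whole induced pentagon need not be pursued further.
C₅⁴-refutation : Refutation 2K₂K₄-adjacent 2K₂K₄-nonadjacent (C₅⁵ ∷ []) C₅⁴
C₅⁴-refutation = record
  { tree =
    rem 10 (lem 0 (1 ∷ 6 ∷ 5 ∷ 4 ∷ 3 ∷ 0 ∷ [])) (rem 17 (lem 0 (0 ∷ 6 ∷ 5 ∷ 4 ∷ 3 ∷ 2 ∷ [])) (ban 14 13 (rem 13 (lem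
    0 (6 ∷ 7 ∷ 3 ∷ 5 ∷ 1 ∷ 0 ∷ [])) (rem 13 (lem 0 (7 ∷ 6 ∷ 3 ∷ 8 ∷ 2 ∷ 0 ∷ [])) (rem 23 (lem 0 (6 ∷ 7 ∷ 3 ∷ 5 ∷ 1 ∷
    0 ∷ [])) (cmp 3 2)))) (ban 4 6 (cmp 7 0) (ban 10 12 (cmp 4 0) (ban 10 14 (rem 11 (lem 0 (7 ∷ 6 ∷ 3 ∷ 8 ∷ 1 ∷ 0 ∷
    [])) (rem 11 (lem 0 (7 ∷ 6 ∷ 3 ∷ 8 ∷ 1 ∷ 0 ∷ [])) (cmp 3 2))) (ban 4 15 (rem 5 (lem 0 (7 ∷ 3 ∷ 6 ∷ 1 ∷ 2 ∷ 0 ∷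
    [])) (cmp 1 5)) (ban 10 16 (cmp 1 6) (ban 7 6 (lem 0 (0 ∷ 6 ∷ 2 ∷ 4 ∷ 3 ∷ 1 ∷ [])) (ban 15 6 (lem 0 (0 ∷ 6 ∷ 2 ∷
    4 ∷ 3 ∷ 1 ∷ [])) (ban 9 16 (lem 0 (0 ∷ 7 ∷ 6 ∷ 5 ∷ 4 ∷ 1 ∷ [])) (leaf 12485130053)))))))))))
  ; valid = refl
  }

C₅³⁰-refutation : Refutation 2K₂K₄-adjacent 2K₂K₄-nonadjacent (C₅⁵ ∷ C₅⁴ ∷ []) C₅³⁰
C₅³⁰-refutation = record
  { tree =
    rem 11 (lem 1 (5 ∷ 7 ∷ 6 ∷ 0 ∷ 4 ∷ 2 ∷ [])) (rem 12 (lem 1 (2 ∷ 6 ∷ 7 ∷ 0 ∷ 4 ∷ 5 ∷ [])) (rem 13 (lem 1 (2 ∷ 3 ∷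
    7 ∷ 0 ∷ 5 ∷ 4 ∷ [])) (rem 18 (lem 1 (0 ∷ 6 ∷ 7 ∷ 3 ∷ 4 ∷ 5 ∷ [])) (rem 18 (lem 1 (0 ∷ 6 ∷ 7 ∷ 3 ∷ 4 ∷ 5 ∷ []))
    (rem 21 (lem 1 (0 ∷ 5 ∷ 6 ∷ 7 ∷ 3 ∷ 4 ∷ [])) (rem 21 (lem 1 (0 ∷ 5 ∷ 6 ∷ 7 ∷ 3 ∷ 4 ∷ [])) (rem 21 (lem 1 (0 ∷ 4
    ∷ 5 ∷ 6 ∷ 7 ∷ 3 ∷ [])) (rem 21 (lem 1 (0 ∷ 4 ∷ 5 ∷ 6 ∷ 7 ∷ 3 ∷ [])) (rem 21 (lem 1 (0 ∷ 3 ∷ 7 ∷ 6 ∷ 5 ∷ 4 ∷ []))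
    (rem 21 (lem 1 (0 ∷ 3 ∷ 7 ∷ 6 ∷ 5 ∷ 4 ∷ [])) (rem 21 (lem 0 (0 ∷ 7 ∷ 6 ∷ 5 ∷ 4 ∷ 3 ∷ [])) (rem 21 (lem 0 (0 ∷ 7
    ∷ 6 ∷ 5 ∷ 4 ∷ 3 ∷ [])) (ban 12 11 (rem 25 (lem 1 (0 ∷ 8 ∷ 9 ∷ 1 ∷ 6 ∷ 7 ∷ [])) (rem 25 (lem 1 (0 ∷ 5 ∷ 9 ∷ 2 ∷ 7
    ∷ 6 ∷ [])) (cmp 2 3))) (ban 13 9 (cmp 2 7) (ban 13 10 (rem 20 (lem 1 (5 ∷ 3 ∷ 1 ∷ 2 ∷ 9 ∷ 0 ∷ [])) (cmp 8 0))
    (ban 18 7 (cmp 2 4) (ban 18 8 (rem 24 (lem 1 (8 ∷ 3 ∷ 1 ∷ 2 ∷ 9 ∷ 0 ∷ [])) (cmp 8 0)) (ban 5 7 (lem 1 (0 ∷ 8 ∷ 7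
    ∷ 1 ∷ 5 ∷ 3 ∷ [])) (ban 5 8 (lem 1 (0 ∷ 8 ∷ 7 ∷ 1 ∷ 5 ∷ 3 ∷ [])) (ban 2 9 (lem 1 (0 ∷ 8 ∷ 4 ∷ 1 ∷ 6 ∷ 3 ∷ []))
    (ban 2 10 (lem 1 (0 ∷ 8 ∷ 4 ∷ 1 ∷ 6 ∷ 3 ∷ [])) (ban 13 3 (lem 1 (1 ∷ 7 ∷ 8 ∷ 4 ∷ 0 ∷ 6 ∷ [])) (ban 2 14 (lem 0
    (0 ∷ 6 ∷ 3 ∷ 8 ∷ 4 ∷ 1 ∷ [])) (ban 2 15 (lem 0 (0 ∷ 6 ∷ 3 ∷ 8 ∷ 4 ∷ 1 ∷ [])) (ban 11 16 (lem 1 (0 ∷ 7 ∷ 8 ∷ 1 ∷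
    5 ∷ 6 ∷ [])) (ban 12 16 (lem 1 (0 ∷ 4 ∷ 8 ∷ 1 ∷ 6 ∷ 5 ∷ [])) (ban 11 17 (lem 1 (0 ∷ 7 ∷ 8 ∷ 1 ∷ 5 ∷ 6 ∷ []))
    (ban 12 17 (lem 1 (0 ∷ 4 ∷ 8 ∷ 1 ∷ 6 ∷ 5 ∷ [])) (ban 18 6 (lem 1 (1 ∷ 4 ∷ 8 ∷ 7 ∷ 0 ∷ 5 ∷ [])) (ban 5 19 (lem 0
    (0 ∷ 7 ∷ 8 ∷ 3 ∷ 5 ∷ 1 ∷ [])) (ban 5 20 (lem 0 (0 ∷ 7 ∷ 8 ∷ 3 ∷ 5 ∷ 1 ∷ [])) (leaf
    1445930293167))))))))))))))))))))))))))))))))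
  ; valid = refl
  }

C₅³¹-refutation : Refutation 2K₂K₄-adjacent 2K₂K₄-nonadjacent (C₅⁵ ∷ C₅⁴ ∷ C₅³⁰ ∷ []) C₅³¹
C₅³¹-refutation = record
  { tree =
    rem 0 (lem 2 (0 ∷ 2 ∷ 6 ∷ 5 ∷ 4 ∷ 3 ∷ 7 ∷ [])) (rem 4 (lem 2 (1 ∷ 0 ∷ 7 ∷ 3 ∷ 4 ∷ 5 ∷ 6 ∷ [])) (rem 5 (lem 2 (1
    ∷ 0 ∷ 7 ∷ 6 ∷ 5 ∷ 4 ∷ 3 ∷ [])) (rem 6 (lem 1 (5 ∷ 7 ∷ 6 ∷ 0 ∷ 4 ∷ 2 ∷ [])) (rem 7 (lem 1 (2 ∷ 6 ∷ 7 ∷ 0 ∷ 4 ∷ 5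
    ∷ [])) (rem 8 (lem 1 (2 ∷ 3 ∷ 7 ∷ 0 ∷ 5 ∷ 4 ∷ [])) (rem 9 (lem 2 (1 ∷ 0 ∷ 6 ∷ 7 ∷ 3 ∷ 4 ∷ 5 ∷ [])) (rem 10 (lem
    2 (1 ∷ 0 ∷ 6 ∷ 5 ∷ 4 ∷ 3 ∷ 7 ∷ [])) (rem 11 (lem 1 (0 ∷ 6 ∷ 7 ∷ 3 ∷ 4 ∷ 5 ∷ [])) (rem 12 (lem 2 (1 ∷ 0 ∷ 5 ∷ 6 ∷
    7 ∷ 3 ∷ 4 ∷ [])) (rem 13 (lem 1 (0 ∷ 5 ∷ 6 ∷ 7 ∷ 3 ∷ 4 ∷ [])) (rem 13 (lem 1 (0 ∷ 5 ∷ 6 ∷ 7 ∷ 3 ∷ 4 ∷ [])) (rem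
    13 (lem 1 (0 ∷ 4 ∷ 5 ∷ 6 ∷ 7 ∷ 3 ∷ [])) (rem 13 (lem 1 (0 ∷ 4 ∷ 5 ∷ 6 ∷ 7 ∷ 3 ∷ [])) (rem 13 (lem 1 (0 ∷ 3 ∷ 7 ∷
    6 ∷ 5 ∷ 4 ∷ [])) (rem 13 (lem 0 (0 ∷ 7 ∷ 6 ∷ 5 ∷ 4 ∷ 3 ∷ [])) (ban 2 1 (lem 2 (2 ∷ 0 ∷ 7 ∷ 1 ∷ 4 ∷ 5 ∷ 6 ∷ []))
    (ban 2 5 (lem 1 (0 ∷ 5 ∷ 6 ∷ 7 ∷ 1 ∷ 4 ∷ [])) (ban 6 3 (lem 2 (2 ∷ 0 ∷ 8 ∷ 1 ∷ 5 ∷ 6 ∷ 7 ∷ [])) (ban 7 10 (lem 1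
    (0 ∷ 4 ∷ 8 ∷ 1 ∷ 6 ∷ 5 ∷ [])) (ban 10 8 (lem 2 (7 ∷ 1 ∷ 4 ∷ 0 ∷ 2 ∷ 3 ∷ 5 ∷ [])) (ban 11 4 (lem 1 (0 ∷ 6 ∷ 7 ∷ 1
    ∷ 2 ∷ 3 ∷ [])) (ban 11 9 (lem 1 (0 ∷ 7 ∷ 6 ∷ 3 ∷ 2 ∷ 1 ∷ [])) (leaf 2268285)))))))))))))))))))))))
  ; valid = refl
  }

-- The purpose of C₅³⁰ and C₅³¹ shows here: they dispose of all vertices without a neighbour on the
-- pentagon.
C₅³-refutation : Refutation 2K₂K₄-adjacent 2K₂K₄-nonadjacent (C₅⁵ ∷ C₅⁴ ∷ C₅³⁰ ∷ C₅³¹ ∷ []) C₅³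
C₅³-refutation = record
  { tree =
    pseudo (7 ∷ []) (8 ∷ []) (pseudo (13 ∷ []) (2 ∷ 3 ∷ []) (pseudo (11 ∷ []) (5 ∷ 6 ∷ []) (pseudo (11 ∷ 12 ∷ [])
    (15 ∷ []) (rem 0 (lem 2 (0 ∷ 1 ∷ 5 ∷ 4 ∷ 3 ∷ 2 ∷ 6 ∷ [])) (rem 0 (lem 3 (0 ∷ 1 ∷ 5 ∷ 4 ∷ 3 ∷ 2 ∷ 6 ∷ [])) (rem 8
    (lem 1 (4 ∷ 6 ∷ 5 ∷ 0 ∷ 3 ∷ 1 ∷ [])) (rem 12 (lem 1 (1 ∷ 5 ∷ 6 ∷ 0 ∷ 3 ∷ 4 ∷ [])) (rem 14 (lem 1 (1 ∷ 2 ∷ 6 ∷ 0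
    ∷ 4 ∷ 3 ∷ [])) (rem 17 (lem 1 (0 ∷ 5 ∷ 6 ∷ 2 ∷ 3 ∷ 4 ∷ [])) (rem 19 (lem 1 (0 ∷ 4 ∷ 5 ∷ 6 ∷ 2 ∷ 3 ∷ [])) (rem 19
    (lem 1 (0 ∷ 3 ∷ 4 ∷ 5 ∷ 6 ∷ 2 ∷ [])) (rem 19 (lem 1 (0 ∷ 2 ∷ 6 ∷ 5 ∷ 4 ∷ 3 ∷ [])) (rem 19 (lem 0 (0 ∷ 6 ∷ 5 ∷ 4
    ∷ 3 ∷ 2 ∷ [])) (ban 6 9 (wit 1 3 ((wit 1 0 ((wit 0 2 []) ∷ [])) ∷ [])) (ban 13 11 (wit 1 2 ((lem 1 (2 ∷ 7 ∷ 8 ∷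
    1 ∷ 0 ∷ 6 ∷ [])) ∷ [])) (ban 17 6 (wit 0 3 []) (ban 2 5 (lem 1 (0 ∷ 5 ∷ 6 ∷ 1 ∷ 3 ∷ 4 ∷ [])) (ban 3 6 (lem 1 (0
    ∷ 7 ∷ 6 ∷ 1 ∷ 4 ∷ 2 ∷ [])) (ban 2 7 (lem 1 (0 ∷ 4 ∷ 5 ∷ 6 ∷ 1 ∷ 3 ∷ [])) (ban 14 1 (lem 1 (1 ∷ 6 ∷ 7 ∷ 3 ∷ 0 ∷ 5
    ∷ [])) (ban 0 15 (lem 0 (0 ∷ 5 ∷ 2 ∷ 7 ∷ 3 ∷ 1 ∷ [])) (ban 12 15 (lem 1 (0 ∷ 4 ∷ 5 ∷ 1 ∷ 7 ∷ 3 ∷ [])) (ban 8 16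
    (lem 1 (0 ∷ 6 ∷ 7 ∷ 1 ∷ 4 ∷ 5 ∷ [])) (ban 16 10 (lem 1 (1 ∷ 6 ∷ 7 ∷ 0 ∷ 4 ∷ 5 ∷ [])) (ban 16 11 (lem 1 (1 ∷ 6 ∷
    7 ∷ 0 ∷ 4 ∷ 5 ∷ [])) (ban 16 13 (lem 1 (1 ∷ 3 ∷ 7 ∷ 0 ∷ 5 ∷ 4 ∷ [])) (ban 17 4 (lem 1 (1 ∷ 3 ∷ 7 ∷ 6 ∷ 0 ∷ 4 ∷
    [])) (ban 3 18 (lem 0 (0 ∷ 6 ∷ 7 ∷ 2 ∷ 4 ∷ 1 ∷ [])) (ban 18 9 (lem 1 (1 ∷ 5 ∷ 6 ∷ 7 ∷ 0 ∷ 4 ∷ [])) (leaf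
    264784131018))))))))))))))))))))))))))))))
  ; valid = refl
  }

C₅-refutation : Refutation 2K₂K₄-adjacent 2K₂K₄-nonadjacent (C₅⁵ ∷ C₅⁴ ∷ C₅³⁰ ∷ C₅³¹ ∷ C₅³ ∷ []) C₅
C₅-refutation = record
  { tree =
    rem 4 (lem 4 (0 ∷ 5 ∷ 1 ∷ 2 ∷ 3 ∷ 4 ∷ [])) (rem 4 (lem 4 (0 ∷ 5 ∷ 4 ∷ 3 ∷ 2 ∷ 1 ∷ [])) (rem 4 (lem 1 (0 ∷ 5 ∷ 4
    ∷ 3 ∷ 2 ∷ 1 ∷ [])) (rem 6 (lem 4 (0 ∷ 4 ∷ 5 ∷ 1 ∷ 2 ∷ 3 ∷ [])) (rem 6 (lem 4 (0 ∷ 4 ∷ 3 ∷ 2 ∷ 1 ∷ 5 ∷ [])) (rem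
    6 (lem 1 (0 ∷ 4 ∷ 5 ∷ 1 ∷ 2 ∷ 3 ∷ [])) (rem 6 (lem 4 (0 ∷ 3 ∷ 4 ∷ 5 ∷ 1 ∷ 2 ∷ [])) (rem 6 (lem 1 (0 ∷ 3 ∷ 4 ∷ 5
    ∷ 1 ∷ 2 ∷ [])) (rem 6 (lem 1 (0 ∷ 2 ∷ 3 ∷ 4 ∷ 5 ∷ 1 ∷ [])) (rem 6 (lem 1 (0 ∷ 1 ∷ 5 ∷ 4 ∷ 3 ∷ 2 ∷ [])) (rem 6
    (lem 0 (0 ∷ 5 ∷ 4 ∷ 3 ∷ 2 ∷ 1 ∷ [])) (ban 2 1 (lem 4 (0 ∷ 5 ∷ 1 ∷ 2 ∷ 3 ∷ 4 ∷ [])) (ban 4 3 (lem 4 (0 ∷ 6 ∷ 1 ∷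
    3 ∷ 4 ∷ 5 ∷ [])) (leaf 981)))))))))))))
  ; valid = refl
  }

K₃-refutation : Refutation 2K₂K₄-adjacent 2K₂K₄-nonadjacent (C₅⁵ ∷ C₅⁴ ∷ C₅³⁰ ∷ C₅³¹ ∷ C₅³ ∷ C₅ ∷ []) K₃
K₃-refutation = record
  { tree =
    pseudo (2 ∷ []) (3 ∷ []) (pseudo (5 ∷ []) (6 ∷ []) (ban 3 6 (wit 1 1 ((lem 1 (4 ∷ 1 ∷ 5 ∷ 3 ∷ 0 ∷ 2 ∷ [])) ∷
    (wit 1 0 ((lem 0 (1 ∷ 4 ∷ 5 ∷ 3 ∷ 2 ∷ 0 ∷ [])) ∷ (rem 1 (lem 1 (5 ∷ 0 ∷ 2 ∷ 6 ∷ 7 ∷ 1 ∷ [])) (rem 1 (lem 1 (2 ∷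
    0 ∷ 5 ∷ 6 ∷ 4 ∷ 3 ∷ [])) (rem 1 (lem 0 (5 ∷ 2 ∷ 6 ∷ 7 ∷ 1 ∷ 0 ∷ [])) (rem 1 (lem 1 (1 ∷ 0 ∷ 5 ∷ 7 ∷ 3 ∷ 4 ∷ []))
    (rem 1 (lem 0 (5 ∷ 2 ∷ 6 ∷ 7 ∷ 1 ∷ 0 ∷ [])) (rem 2 (lem 1 (4 ∷ 0 ∷ 6 ∷ 2 ∷ 3 ∷ 1 ∷ [])) (rem 2 (lem 1 (7 ∷ 0 ∷ 6
    ∷ 5 ∷ 1 ∷ 3 ∷ [])) (rem 3 (lem 1 (4 ∷ 0 ∷ 6 ∷ 2 ∷ 3 ∷ 1 ∷ [])) (rem 4 (lem 1 (7 ∷ 0 ∷ 6 ∷ 5 ∷ 1 ∷ 3 ∷ [])) (rem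
    8 (lem 0 (4 ∷ 6 ∷ 2 ∷ 3 ∷ 1 ∷ 0 ∷ [])) (rem 9 (lem 1 (3 ∷ 0 ∷ 7 ∷ 1 ∷ 4 ∷ 2 ∷ [])) (rem 9 (lem 1 (6 ∷ 0 ∷ 7 ∷ 5
    ∷ 2 ∷ 4 ∷ [])) (rem 10 (lem 1 (3 ∷ 0 ∷ 7 ∷ 1 ∷ 4 ∷ 2 ∷ [])) (rem 11 (lem 1 (6 ∷ 0 ∷ 7 ∷ 5 ∷ 2 ∷ 4 ∷ [])) (rem 13
    (lem 0 (3 ∷ 7 ∷ 1 ∷ 4 ∷ 2 ∷ 0 ∷ [])) (rem 17 (lem 0 (3 ∷ 7 ∷ 1 ∷ 4 ∷ 2 ∷ 0 ∷ [])) (rem 17 (lem 0 (4 ∷ 6 ∷ 2 ∷ 3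
    ∷ 1 ∷ 0 ∷ [])) (rem 17 (lem 0 (7 ∷ 6 ∷ 5 ∷ 1 ∷ 3 ∷ 0 ∷ [])) (ban 6 3 (rem 1 (lem 4 (7 ∷ 5 ∷ 9 ∷ 8 ∷ 1 ∷ 0 ∷ []))
    (rem 2 (lem 4 (1 ∷ 5 ∷ 2 ∷ 8 ∷ 0 ∷ 3 ∷ [])) (rem 6 (lem 4 (7 ∷ 5 ∷ 0 ∷ 8 ∷ 1 ∷ 3 ∷ [])) (rem 10 (lem 4 (9 ∷ 6 ∷
    3 ∷ 7 ∷ 2 ∷ 0 ∷ [])) (rem 10 (lem 4 (9 ∷ 6 ∷ 3 ∷ 7 ∷ 2 ∷ 0 ∷ [])) (rem 10 (lem 4 (4 ∷ 3 ∷ 6 ∷ 8 ∷ 2 ∷ 0 ∷ []))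
    (rem 10 (lem 4 (9 ∷ 6 ∷ 3 ∷ 7 ∷ 2 ∷ 0 ∷ [])) (rem 10 (lem 4 (9 ∷ 6 ∷ 3 ∷ 7 ∷ 2 ∷ 0 ∷ [])) (rem 12 (lem 4 (6 ∷ 9
    ∷ 5 ∷ 4 ∷ 1 ∷ 0 ∷ [])) (rem 12 (lem 4 (6 ∷ 9 ∷ 5 ∷ 4 ∷ 1 ∷ 0 ∷ [])) (rem 12 (lem 1 (4 ∷ 2 ∷ 5 ∷ 6 ∷ 0 ∷ 1 ∷ []))
    (rem 12 (lem 1 (7 ∷ 1 ∷ 3 ∷ 9 ∷ 0 ∷ 2 ∷ [])) (leaf 693891278))))))))))))) (ban 6 16 (rem 4 (lem 4 (1 ∷ 5 ∷ 2 ∷ 8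
    ∷ 0 ∷ 3 ∷ [])) (rem 8 (lem 1 (9 ∷ 0 ∷ 8 ∷ 1 ∷ 3 ∷ 5 ∷ [])) (rem 12 (lem 4 (9 ∷ 6 ∷ 3 ∷ 1 ∷ 2 ∷ 0 ∷ [])) (rem 12
    (lem 4 (9 ∷ 6 ∷ 3 ∷ 7 ∷ 2 ∷ 0 ∷ [])) (rem 12 (lem 4 (4 ∷ 3 ∷ 6 ∷ 8 ∷ 2 ∷ 0 ∷ [])) (rem 12 (lem 4 (9 ∷ 6 ∷ 3 ∷ 1
    ∷ 2 ∷ 0 ∷ [])) (rem 12 (lem 4 (9 ∷ 6 ∷ 3 ∷ 7 ∷ 2 ∷ 0 ∷ [])) (rem 13 (lem 4 (3 ∷ 2 ∷ 5 ∷ 6 ∷ 0 ∷ 1 ∷ [])) (rem 13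
    (lem 1 (8 ∷ 0 ∷ 6 ∷ 4 ∷ 1 ∷ 2 ∷ [])) (rem 14 (lem 1 (4 ∷ 2 ∷ 5 ∷ 6 ∷ 0 ∷ 1 ∷ [])) (rem 14 (lem 4 (9 ∷ 6 ∷ 3 ∷ 1
    ∷ 2 ∷ 0 ∷ [])) (rem 17 (lem 1 (9 ∷ 2 ∷ 8 ∷ 0 ∷ 3 ∷ 5 ∷ [])) (leaf 62999778641))))))))))))) (ban 13 6 (rem 2 (lem
    4 (8 ∷ 5 ∷ 4 ∷ 7 ∷ 2 ∷ 0 ∷ [])) (rem 2 (lem 4 (3 ∷ 4 ∷ 5 ∷ 9 ∷ 2 ∷ 0 ∷ [])) (rem 2 (lem 4 (8 ∷ 5 ∷ 4 ∷ 7 ∷ 2 ∷ 0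
    ∷ [])) (rem 4 (lem 4 (1 ∷ 6 ∷ 2 ∷ 7 ∷ 0 ∷ 5 ∷ [])) (rem 8 (lem 4 (9 ∷ 6 ∷ 3 ∷ 7 ∷ 1 ∷ 0 ∷ [])) (rem 8 (lem 4 (4
    ∷ 3 ∷ 6 ∷ 8 ∷ 1 ∷ 0 ∷ [])) (rem 8 (lem 4 (4 ∷ 3 ∷ 6 ∷ 8 ∷ 1 ∷ 0 ∷ [])) (rem 8 (lem 4 (9 ∷ 6 ∷ 3 ∷ 7 ∷ 1 ∷ 0 ∷
    [])) (rem 10 (lem 4 (9 ∷ 6 ∷ 0 ∷ 7 ∷ 1 ∷ 5 ∷ [])) (rem 14 (lem 1 (9 ∷ 1 ∷ 5 ∷ 3 ∷ 0 ∷ 2 ∷ [])) (leaf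
    259367439))))))))))) (ban 13 10 (rem 1 (lem 4 (7 ∷ 6 ∷ 8 ∷ 9 ∷ 1 ∷ 0 ∷ [])) (rem 1 (lem 4 (8 ∷ 5 ∷ 4 ∷ 7 ∷ 2 ∷ 0
    ∷ [])) (rem 1 (lem 4 (8 ∷ 5 ∷ 4 ∷ 7 ∷ 2 ∷ 0 ∷ [])) (rem 1 (lem 4 (3 ∷ 4 ∷ 5 ∷ 9 ∷ 2 ∷ 0 ∷ [])) (rem 1 (lem 4 (8
    ∷ 5 ∷ 4 ∷ 7 ∷ 2 ∷ 0 ∷ [])) (rem 1 (lem 4 (8 ∷ 5 ∷ 4 ∷ 7 ∷ 2 ∷ 0 ∷ [])) (rem 3 (lem 4 (5 ∷ 8 ∷ 6 ∷ 3 ∷ 1 ∷ 0 ∷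
    [])) (rem 3 (lem 1 (3 ∷ 2 ∷ 6 ∷ 5 ∷ 0 ∷ 1 ∷ [])) (rem 3 (lem 1 (7 ∷ 1 ∷ 4 ∷ 8 ∷ 0 ∷ 2 ∷ [])) (rem 7 (lem 4 (1 ∷
    6 ∷ 2 ∷ 9 ∷ 0 ∷ 4 ∷ [])) (rem 11 (lem 4 (7 ∷ 6 ∷ 0 ∷ 9 ∷ 1 ∷ 4 ∷ [])) (leaf 3762080341)))))))))))) (ban 13 16
    (rem 2 (lem 4 (8 ∷ 5 ∷ 4 ∷ 1 ∷ 2 ∷ 0 ∷ [])) (rem 2 (lem 4 (8 ∷ 5 ∷ 4 ∷ 7 ∷ 2 ∷ 0 ∷ [])) (rem 2 (lem 4 (3 ∷ 4 ∷ 5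
    ∷ 9 ∷ 2 ∷ 0 ∷ [])) (rem 2 (lem 4 (8 ∷ 5 ∷ 4 ∷ 1 ∷ 2 ∷ 0 ∷ [])) (rem 2 (lem 4 (8 ∷ 5 ∷ 4 ∷ 7 ∷ 2 ∷ 0 ∷ [])) (rem
    3 (lem 1 (3 ∷ 2 ∷ 6 ∷ 5 ∷ 0 ∷ 1 ∷ [])) (rem 3 (lem 4 (8 ∷ 5 ∷ 4 ∷ 1 ∷ 2 ∷ 0 ∷ [])) (rem 8 (lem 4 (1 ∷ 6 ∷ 2 ∷ 9
    ∷ 0 ∷ 4 ∷ [])) (rem 12 (lem 1 (8 ∷ 0 ∷ 9 ∷ 1 ∷ 4 ∷ 6 ∷ [])) (rem 16 (lem 1 (8 ∷ 2 ∷ 9 ∷ 0 ∷ 4 ∷ 6 ∷ [])) (leaf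
    14657691703))))))))))) (ban 6 10 (lem 4 (3 ∷ 2 ∷ 5 ∷ 7 ∷ 1 ∷ 0 ∷ [])) (ban 13 3 (lem 4 (2 ∷ 3 ∷ 4 ∷ 8 ∷ 1 ∷ 0 ∷
    [])) (leaf 13668742608)))))))))))))))))))))))))) ∷ [])) ∷ [])) (ban 8 3 (wit 0 1 ((lem 0 (4 ∷ 3 ∷ 5 ∷ 2 ∷ 1 ∷ 0
    ∷ [])) ∷ [])) (ban 8 6 (wit 0 0 ((lem 0 (5 ∷ 3 ∷ 4 ∷ 2 ∷ 1 ∷ 0 ∷ [])) ∷ [])) (leaf 156815)))))
  ; valid = refl
  }

-- Unless a triangle contains an end of the chosen edge, the neighbours of either end are
-- independent, and so is the rest because 2K₂ is excluded: three colours suffice.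
2K₂K₄-refutation : Refutation 2K₂K₄-adjacent 2K₂K₄-nonadjacent (C₅⁵ ∷ C₅⁴ ∷ C₅³⁰ ∷ C₅³¹ ∷ C₅³ ∷ C₅ ∷ K₃ ∷ []) []
2K₂K₄-refutation = record
  { tree =
    ban 0 0 (rem 3 (lem 6 (0 ∷ 1 ∷ 2 ∷ [])) (ban 2 2 (lem 6 (0 ∷ 1 ∷ 3 ∷ [])) (ban 1 1 (lem 6 (0 ∷ 1 ∷ 2 ∷ []))
    (leaf 6)))) (leaf 0)
  ; valid = refl
  }

-- The search proper starts from an induced 2K₂. If no edge lies apart from the first one, the
-- neighbourhoods of its ends and the remaining vertices are three independent sets.
3K₂K₃-refutation : Refutation 3K₂K₃-adjacent 3K₂K₃-nonadjacent [] []
3K₂K₃-refutation = record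
  { tree =
    ban 0 0 (ban 0 0 (pseudo (0 ∷ []) (2 ∷ []) (ban 2 1 (wit 0 0 ((pseudo (0 ∷ 1 ∷ 2 ∷ []) (18 ∷ 19 ∷ 20 ∷ 21 ∷ 22 ∷
    []) (ban 10 1 (wit 0 0 ((ban 9 26 (leaf 1158235750945466082132364) (ban 13 34 (leaf 1772867471322708606689587)
    (leaf 302014424564150361655596))) ∷ (leaf 846246972804294690453781487) ∷ [])) (ban 10 3 (wit 0 0 ((ban 10 15
    (leaf 909696001942446360690628) (ban 14 34 (leaf 442730701434322207015360) (leaf 785825100622056973139424))) ∷
    (leaf 32903661253119572754997035264) ∷ [])) (ban 10 5 (wit 0 0 ((leaf 6196147800414153680853330602) ∷ [])) (ban
    11 1 (wit 0 0 ((leaf 825092164344833055436502357) ∷ (leaf 28885267632480969286704827375) ∷ (ban 8 17 (leaf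
    226853180541415320283195569013945338928) (ban 39 18 (leaf 903958025979833141986490438541087453183) (ban 8 13
    (leaf 1938622925354305280859384038861895322) (ban 8 14 (leaf 5316851135910850863906443848616812869) (ban 37 15
    (leaf 112984366132826122582531257685030162432) (ban 41 15 (leaf 158455116794082156913086146525) (ban 43 15 (leaf
    1749803196846418679301645195777627087) (leaf 20176773637199545229510484292949)))))))) ∷ [])) (ban 11 3 (wit 0 0
    ((leaf 26203039028110624641774162944) ∷ (leaf 13191798560540748415484919040) ∷ (ban 7 16 (leaf
    84032132343382152421587475393315963136) (ban 33 4 (leaf 212611089047676540465697032264) (ban 35 34 (leaf
    17199503150742058642534204046647842) (leaf 4994695157354678202167122902101)))) ∷ [])) (ban 12 1 (wit 0 0 ((leaf
    316835297497278666621281544874) ∷ [])) (ban 12 3 (wit 0 0 ((leaf 3771848630978613443785217365) ∷ [])) (ban 12 5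
    (wit 0 0 ((pseudo (0 ∷ 1 ∷ 2 ∷ 3 ∷ 11 ∷ []) (36 ∷ 38 ∷ 39 ∷ 41 ∷ 42 ∷ 43 ∷ 46 ∷ 47 ∷ []) (ban 22 16 (wit 0 0 [])
    (ban 25 16 (wit 0 0 []) (ban 28 1 (wit 0 0 []) (ban 28 3 (wit 0 0 []) (ban 28 5 (wit 0 0 []) (ban 28 7 (wit 0 0
    []) (leaf 52500601853081525716588709670638)))))))) ∷ [])) (ban 13 1 (wit 0 0 ((leaf
    14441330409952899700241010037) ∷ (leaf 52818754595127773201188610047) ∷ (ban 37 18 (leaf
    4537563781261944827286518862414810641749) (ban 17 9 (leaf 7089432323221977680324536371916087424) (ban 35 10
    (leaf 48658677532676775539270414802944) (ban 8 38 (leaf 108167477101879061338821954171855) (ban 22 38 (leaf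
    3380478970206816774257174904832) (leaf 634626012769051706836361239535)))))) ∷ [])) (ban 13 3 (wit 0 0 ((leaf
    4639696730655361335553245951) ∷ (leaf 377807763499522029082282) ∷ (ban 16 8 (leaf
    3544555151401100209880886866044009557) (ban 5 39 (leaf 794227598812059986424294071773) (ban 6 39 (leaf
    107784504697528870439619889288) (ban 16 43 (leaf 266105213999126787394877353130039705) (leaf
    845048819612330615326635278677))))) ∷ [])) (ban 14 1 (wit 0 0 ((leaf 26409387507820933100349818912) ∷ (ban 14 18
    (leaf 216339102708942645680367744447439) (leaf 4964141989165534926438914913946)) ∷ (ban 11 18 (leaf
    135217675726335257439331452670927) (leaf 76615655373964593924234223)) ∷ (ban 17 9 (leaf
    121207679131307939417059040365268992) (ban 13 8 (leaf 60847229418959649404091809310037) (ban 36 18 (leaf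
    865389331111095512322416817403871) (ban 8 18 (leaf 47358609939002395658556144330069) (ban 28 8 (leaf
    13737952104508211199534251715821431) (ban 8 29 (leaf 332090652831344829466775525767512832) (ban 8 30 (leaf
    2798972576884814710070379262721843) (ban 34 8 (leaf 221646172148656651609935445747564544) (ban 31 8 (leaf
    1811895915582329079238910165381375) (ban 8 33 (leaf 6602271564282084387527540531) (ban 9 35 (leaf
    2775667741763038991472890417427) (ban 35 10 (leaf 709541012473623193035304550190318) (ban 11 35 (leaf
    3487925414720744091042829234540119296) (ban 0 32 (leaf 63886020544832712368807096351599187285) (ban 1 32 (leaf
    5399988732824615991721195200175450666) (ban 3 32 (leaf 4001530112317288096758777503032873297) (ban 4 32 (leaf
    664309444895393444767921172176878266) (leaf 13846124956089860707882611924340735)))))))))))))))))) ∷ [])) (ban 14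
    3 (wit 0 0 ((leaf 11868427746814965846902817536) ∷ (ban 13 17 (leaf 2535301502760067565107213074090) (leaf
    52921935102280408969867411882)) ∷ (ban 10 17 (leaf 54086012963045738401492692222720) (ban 10 25 (leaf
    1224735246079297005523883394112) (leaf 1267650505776361709577279285504))) ∷ (ban 36 17 (ban 26 8 (leaf
    577459176671250472754988028537677177225215) (ban 26 9 (leaf 14065005040158412597485624059326795677695) (ban 26
    34 (leaf 648724153471973380590427363213311) (ban 26 61 (leaf 907252798640778653386211688489580921088) (ban 26 29
    (leaf 220794355275855939577373840778034858) (ban 26 31 (leaf 50067574425623987973525888221136324744) (ban 26 33
    (leaf 8777902305089229791344861642301317683) (ban 26 35 (leaf 1807750263569968786220041558564681023487) (ban 18
    7 (leaf 459069353263099303348680753500539952474112) (ban 10 30 (leaf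
    14867275479096908318437532534432402425987925) (ban 15 29 (leaf 243583635259245796491090076789002952772010590549)
    (ban 4 31 (leaf 1329227792300033515383814626328047342) (ban 4 33 (leaf
    237871069958148940867731670978087852013322235) (ban 4 35 (leaf 453709829298121079105986353554042912767) (ban 5
    32 (leaf 469738459800869146737083648416790055795336874) (ban 6 32 (leaf
    356798300375683241497241592951234384548069376) (ban 26 38 (leaf 7116735182656966740135534737666155042) (ban 26
    41 (leaf 862419703545116733296348818833407) (ban 0 36 (leaf 309058494753616677587799715379400081407) (ban 1 36
    (leaf 79852930176215184234901167813433811539285) (ban 2 36 (leaf 21771425094813328872457421687748069534101) (ban
    3 36 (leaf 3631092142746123207459822590570016374613) (leaf
    7604620483711255066898918300053603103970945962))))))))))))))))))))))) (leaf 1643244908927222960383836365176831))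
    ∷ [])) (leaf 97575083516649198)))))))))))))) ∷ [])) (leaf 5566))) (leaf 6)) (leaf 0)
  ; valid = refl
  }


-- Four-colourability of the two classes

module _ {n} (G : SimpleGraph (suc n)) where

  critical : (∀ v → Colourable (pull G (punchIn v)) 4) → Critical G
  critical smaller v = (λ x → col x (v ≟ᶠ x)) , λ x y x≢v y≢v xy → proper x y (v ≟ᶠ x) (v ≟ᶠ y) x≢v y≢v xy
    where
    c = proj₁ (smaller v)
    col : ∀ x → Dec (v ≡ x) → Fin 4
    -- The colour of v is arbitrary: only pairs that avoid v are tested.
    col x (yes _)   = zero
    col x (no v≢x) = c (punchOut v≢x)
    proper : ∀ x y d e → x ≢ v → y ≢ v → adj G x y ≡ true → col x d ≢ col y e
    proper x y (yes refl) _          x≢v _   _  _ = x≢v refl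
    proper x y (no _)     (yes refl) _   y≢v _  _ = y≢v refl
    proper x y (no v≢x)   (no v≢y)   _   _   xy =
      proj₂ (smaller v) _ _ (trans (cong₂ (adj G) (punchIn-punchOut v≢x) (punchIn-punchOut v≢y)) xy)

trivially-critical : (G : SimpleGraph 0) → Critical G
trivially-critical G ()

module _ {n} (G : SimpleGraph n) (two : MatchingFree G 2) (ω : ω≤ G 3) where

  2K₂K₄-avoids-adjacent : All (Avoids G true) 2K₂K₄-adjacent
  2K₂K₄-avoids-adjacent = 2K₂ ∷ K₄ ∷ []
    where
    2K₂ : Avoids G true _
    2K₂ x y (u ∷ v ∷ []) xy (xu , yu , (uv , _) , xv , yv , _) =
      1+n≰n (two ((x , y) ∷ (u , v) ∷ []) (xy ∷ uv ∷ []) (((xu , xv , yu , yv) ∷ []) ∷ [] ∷ []))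
    2K₂ x y (u ∷ []) _ (_ , _ , _ , ())
    2K₂ x y (u ∷ v ∷ w ∷ ws) _ (_ , _ , _ , _ , _ , _ , ())
    K₄ : Avoids G true _
    K₄ x y (u ∷ v ∷ []) xy (xu , yu , (uv , _) , xv , yv , _) =
      1+n≰n (ω (x ∷ y ∷ u ∷ v ∷ []) ((xy ∷ xu ∷ xv ∷ []) ∷ (yu ∷ yv ∷ []) ∷ (uv ∷ []) ∷ [] ∷ []))
    K₄ x y (u ∷ []) _ (_ , _ , _ , ())
    K₄ x y (u ∷ v ∷ w ∷ ws) _ (_ , _ , _ , _ , _ , _ , ())

  2K₂K₄-avoids-nonadjacent : All (Avoids G false) 2K₂K₄-nonadjacent
  2K₂K₄-avoids-nonadjacent = 2K₂ ∷ []
    where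
    2K₂ : Avoids G false _
    2K₂ x y (u ∷ v ∷ []) xy (xu , yu , (uv , _) , xv , yv , _) =
      1+n≰n (two ((x , u) ∷ (y , v) ∷ []) (xu ∷ yv ∷ []) (((xy , xv , ~-sym G yu , uv) ∷ []) ∷ [] ∷ []))
    2K₂ x y (u ∷ []) _ (_ , _ , _ , ())
    2K₂ x y (u ∷ v ∷ w ∷ ws) _ (_ , _ , _ , _ , _ , _ , ())

  2K₂K₄Free-critical⇒colourable : Critical G → Colourable G 4
  2K₂K₄Free-critical⇒colourable crit =
    refute (r₁ ∷ r₂ ∷ r₃ ∷ r₄ ∷ r₅ ∷ r₆ ∷ r₇ ∷ []) 2K₂K₄-refutation [] tt
    where
    Refuted : List Bits → Set
    Refuted F = ∀ ws → Copy G F ws → Colourable G 4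
    refute : ∀ {Ls} → All Refuted Ls → ∀ {F} → Refutation 2K₂K₄-adjacent 2K₂K₄-nonadjacent Ls F → Refuted F
    refute ls = Soundness.refutation-sound G 2K₂K₄-adjacent 2K₂K₄-nonadjacent _
      2K₂K₄-avoids-adjacent 2K₂K₄-avoids-nonadjacent crit ls
    r₁ : Refuted C₅⁵
    r₁ = refute [] C₅⁵-refutation
    r₂ : Refuted C₅⁴
    r₂ = refute (r₁ ∷ []) C₅⁴-refutation
    r₃ : Refuted C₅³⁰
    r₃ = refute (r₁ ∷ r₂ ∷ []) C₅³⁰-refutation
    r₄ : Refuted C₅³¹
    r₄ = refute (r₁ ∷ r₂ ∷ r₃ ∷ []) C₅³¹-refutation
    r₅ : Refuted C₅³
    r₅ = refute (r₁ ∷ r₂ ∷ r₃ ∷ r₄ ∷ []) C₅³-refutation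
    r₆ : Refuted C₅
    r₆ = refute (r₁ ∷ r₂ ∷ r₃ ∷ r₄ ∷ r₅ ∷ []) C₅-refutation
    r₇ : Refuted K₃
    r₇ = refute (r₁ ∷ r₂ ∷ r₃ ∷ r₄ ∷ r₅ ∷ r₆ ∷ []) K₃-refutation

-- Induction on the number of vertices takes the place of a minimal counterexample: colourings of
-- the vertex-deleted subgraphs provide `Critical`.
2K₂K₄Free-4-colourable : ∀ n (G : SimpleGraph n) → MatchingFree G 2 → ω≤ G 3 → Colourable G 4
2K₂K₄Free-4-colourable zero    G two ω = 2K₂K₄Free-critical⇒colourable G two ω (trivially-critical G)
2K₂K₄Free-4-colourable (suc n) G two ω = 2K₂K₄Free-critical⇒colourable G two ω (critical G λ v →
  2K₂K₄Free-4-colourable n (pull G (punchIn v)) (pull-matchingFree G (punchIn v) two) (pull-ω≤ G (punchIn v) ω))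

module _ {n} (G : SimpleGraph n) (three : MatchingFree G 3) (ω : ω≤ G 2) where

  3K₂K₃-avoids-adjacent : All (Avoids G true) 3K₂K₃-adjacent
  3K₂K₃-avoids-adjacent = K₃′ ∷ 3K₂ ∷ []
    where
    K₃′ : Avoids G true _
    K₃′ x y (u ∷ []) xy (xu , yu , _) =
      1+n≰n (ω (x ∷ y ∷ u ∷ []) ((xy ∷ xu ∷ []) ∷ (yu ∷ []) ∷ [] ∷ []))
    K₃′ x y (u ∷ v ∷ ws) _ (_ , _ , _ , ())
    3K₂ : Avoids G true _
    3K₂ x y (a ∷ b ∷ c ∷ d ∷ []) xy
      (xa , ya , (ab , ac , ad , _) , xb , yb , (bc , bd , _) , xc , yc , (cd , _) , xd , yd , _) =
      1+n≰n (three ((x , y) ∷ (a , b) ∷ (c , d) ∷ []) (xy ∷ ab ∷ cd ∷ [])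
        (((xa , xb , ya , yb) ∷ (xc , xd , yc , yd) ∷ []) ∷ ((ac , ad , bc , bd) ∷ []) ∷ [] ∷ []))
    3K₂ x y (_ ∷ []) _ (_ , _ , _ , ())
    3K₂ x y (_ ∷ _ ∷ []) _ (_ , _ , _ , _ , _ , _ , ())
    3K₂ x y (_ ∷ _ ∷ _ ∷ []) _ (_ , _ , _ , _ , _ , _ , _ , _ , _ , ())
    3K₂ x y (_ ∷ _ ∷ _ ∷ _ ∷ _ ∷ _) _ (_ , _ , _ , _ , _ , _ , _ , _ , _ , _ , _ , _ , ())

  3K₂K₃-avoids-nonadjacent : All (Avoids G false) 3K₂K₃-nonadjacent
  3K₂K₃-avoids-nonadjacent = 3K₂ ∷ []
    where
    3K₂ : Avoids G false _
    3K₂ x y (a ∷ b ∷ c ∷ d ∷ []) xy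
      (xa , ya , (ab , ac , ad , _) , xb , yb , (bc , bd , _) , xc , yc , (cd , _) , xd , yd , _) =
      1+n≰n (three ((x , a) ∷ (y , b) ∷ (c , d) ∷ []) (xa ∷ yb ∷ cd ∷ [])
        (((xy , xb , ~-sym G ya , ab) ∷ (xc , xd , ac , ad) ∷ []) ∷ ((yc , yd , bc , bd) ∷ []) ∷ [] ∷ []))
    3K₂ x y (_ ∷ []) _ (_ , _ , _ , ())
    3K₂ x y (_ ∷ _ ∷ []) _ (_ , _ , _ , _ , _ , _ , ())
    3K₂ x y (_ ∷ _ ∷ _ ∷ []) _ (_ , _ , _ , _ , _ , _ , _ , _ , _ , ())
    3K₂ x y (_ ∷ _ ∷ _ ∷ _ ∷ _ ∷ _) _ (_ , _ , _ , _ , _ , _ , _ , _ , _ , _ , _ , _ , ())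

  3K₂K₃Free-critical⇒colourable : Critical G → Colourable G 4
  3K₂K₃Free-critical⇒colourable crit =
    Soundness.refutation-sound G 3K₂K₃-adjacent 3K₂K₃-nonadjacent [] 3K₂K₃-avoids-adjacent 3K₂K₃-avoids-nonadjacent
      crit [] 3K₂K₃-refutation [] tt

3K₂K₃Free-4-colourable : ∀ n (G : SimpleGraph n) → MatchingFree G 3 → ω≤ G 2 → Colourable G 4
3K₂K₃Free-4-colourable zero    G three ω = 3K₂K₃Free-critical⇒colourable G three ω (trivially-critical G)
3K₂K₃Free-4-colourable (suc n) G three ω = 3K₂K₃Free-critical⇒colourable G three ω (critical G λ v →
  3K₂K₃Free-4-colourable n (pull G (punchIn v)) (pull-matchingFree G (punchIn v) three) (pull-ω≤ G (punchIn v) ω))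

-- Covers at an edge or a triangle, and the recurrences for `g` and `f`

lookup-pairs : ∀ {A : Set} {R : A → A → Set} → (∀ {x y} → R x y → R y x) → ∀ {xs} → AllPairs R xs →
  ∀ {i j} → i ≢ j → R (lookup xs i) (lookup xs j)
lookup-pairs R-sym (h ∷ hs) {zero}  {zero}  i≢j = ⊥-elim (i≢j refl)
lookup-pairs R-sym (h ∷ hs) {zero}  {suc j} i≢j = All.lookup h (∈-lookup j)
lookup-pairs R-sym (h ∷ hs) {suc i} {zero}  i≢j = R-sym (All.lookup h (∈-lookup i))
lookup-pairs R-sym (h ∷ hs) {suc i} {suc j} i≢j = lookup-pairs R-sym hs (i≢j ∘ cong suc)

module _ {n} (G : SimpleGraph n) where

  clique-lookup : ∀ {xs} → Clique G xs → ∀ {i j} → i ≢ j → adj G (lookup xs i) (lookup xs j) ≡ true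
  clique-lookup = lookup-pairs (~-sym G)

  list? : ∀ k {P : List (Fin n) → Set} → (∀ xs → Dec (P xs)) → Dec (∃ λ xs → length xs ≡ k × P xs)
  list? zero    P? = map′ (λ p → [] , refl , p) (λ where ([] , _ , p) → p) (P? [])
  list? (suc k) P? = map′ (λ (x , xs , e , p) → x ∷ xs , cong suc e , p)
    (λ where (x ∷ xs , e , p) → x , xs , suc-injective e , p) (any? λ x → list? k (λ xs → P? (x ∷ xs)))

  -- The length found is the clique number itself, possibly below m; colouring by missed members
  -- relies on a clique that cannot be enlarged.
  maximum-clique : ∀ m → ω≤ G m → ∃ λ xs → Clique G xs × length xs ≤ m × ω≤ G (length xs)
  maximum-clique zero ω = [] , [] , z≤n , ω
  maximum-clique (suc m) ω with list? (suc m) (allPairs? (λ x y → adj G x y ≟ᵇ true))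
  ... | yes (xs , len , c) = xs , c , ≤-reflexive len , subst (ω≤ G) (sym len) ω
  ... | no none with maximum-clique m (λ xs c → s≤s⁻¹ (≤∧≢⇒< (ω xs c) λ len → none (xs , len , c)))
  ... | xs , c , len , ω′ = xs , c , ≤-trans len (n≤1+n m) , ω′

  weaken-ω : ∀ {a b} → a ≤ b → ω≤ G a → ω≤ G b
  weaken-ω a≤b ω xs c = ≤-trans (ω xs c) a≤b

  empty-colourable : ω≤ G 0 → ∀ k → Colourable G k
  empty-colourable ω k = (λ v → ⊥-elim (1+n≰n (ω (v ∷ []) ([] ∷ [])))) , λ u → ⊥-elim (1+n≰n (ω (u ∷ []) ([] ∷ [])))

  ω≤1-colourable : ω≤ G 1 → Colourable G 1
  ω≤1-colourable ω = edgeless-colourable G λ a b e → 1+n≰n (ω (a ∷ b ∷ []) ((e ∷ []) ∷ [] ∷ []))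

  module AtEdge (a b : Fin n) (ab : adj G a b ≡ true) where

    neither : Fin n → Bool
    neither v = not (adj G v a) ∧ not (adj G v b)

    neither-far : ∀ v → neither v ≡ true → adj G v a ≡ false × adj G v b ≡ false
    neither-far v e with adj G v a | adj G v b
    neither-far v e | false | false = refl , refl

    covered : ∀ v → adj G v a ∨ (adj G v b ∨ neither v) ≡ true
    covered v with adj G v a | adj G v b
    ... | true  | _     = refl
    ... | false | true  = refl
    ... | false | false = refl

    rest : Sub G neither
    rest = sub G neither

    rest-matchingFree : ∀ {p} → MatchingFree G (suc p) → MatchingFree (pull G (Sub.emb rest)) p
    rest-matchingFree = sub-matchingFree G rest a b ab neither-far

    combine : ∀ {i j k} → ColOn G (λ v → adj G v a) i → ColOn G (λ v → adj G v b) j →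
      Colourable (pull G (Sub.emb rest)) k → Colourable G (i + (j + k))
    combine A B C = colOn-all G covered (colOn-∨ G A (colOn-∨ G B (sub-colOn G rest C)))

  triangleFree-nbhd : ω≤ G 2 → ∀ a → ColOn G (λ v → adj G v a) 1
  triangleFree-nbhd ω a = colOn-independent G λ u v ua va uv →
    1+n≰n (ω (a ∷ u ∷ v ∷ []) ((~-sym G ua ∷ ~-sym G va ∷ []) ∷ (uv ∷ []) ∷ [] ∷ []))

  -- A P₄ among the neighbours of a would form a gem with a, so the neighbourhood falls to the
  -- greedy bound.
  gemFree-nbhd : ∀ {m} → GemFree G → ω≤ G (suc m) → ∀ a → ColOn G (λ v → adj G v a) m
  gemFree-nbhd {m} gem ω a = sub-colOn G S (P₄Free-colourable (pull G emb) m
    (λ {x} {y} {z} {t} p → gem (joined (near x) (near y) (near z) (near t)) (pull-path G emb p))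
    (sub-ω≤ G S (a ∷ []) ([] ∷ []) (λ v e → ~-sym G e ∷ []) ω))
    where
    S = sub G (λ v → adj G v a)
    open Sub S
    near : ∀ i → adj G a (emb i) ≡ true
    near i = ~-sym G (inside i)

-- The two neighbourhoods of an edge contain no edge as triangles are excluded, and the rest
-- contains none as 2K₂ is.
2K₂K₃Free-colourable : ∀ {n} (G : SimpleGraph n) → MatchingFree G 2 → ω≤ G 2 → Colourable G 3
2K₂K₃Free-colourable G two ω with edge? G
... | inj₂ none = weaken G (s≤s z≤n) (edgeless-colourable G none)
... | inj₁ (a , b , ab) = combine (triangleFree-nbhd G ω a) (triangleFree-nbhd G ω b)
  (edgeless-colourable (pull G (Sub.emb rest)) λ x y e → 1+n≰n (rest-matchingFree two ((x , y) ∷ []) (e ∷ []) ([] ∷ [])))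
  where open AtEdge G a b ab

third : ∀ {k} (i j : Fin (3 + k)) → ∃ λ l → i ≢ l × j ≢ l
third zero             zero             = suc zero , (λ ()) , (λ ())
third zero             (suc zero)       = suc (suc zero) , (λ ()) , (λ ())
third zero             (suc (suc _))    = suc zero , (λ ()) , (λ ())
third (suc zero)       zero             = suc (suc zero) , (λ ()) , (λ ())
third (suc (suc _))    zero             = suc zero , (λ ()) , (λ ())
third (suc _)          (suc _)          = zero , (λ ()) , (λ ())

-- With p = 3 + q these are 2p - 2 colours. An edge ab costs one colour for each of its two
-- independent neighbourhoods, and its removal lowers p by one.
triangleFree-colourable : ∀ q {n} (G : SimpleGraph n) → MatchingFree G (3 + q) → ω≤ G 2 → Colourable G (4 + 2 * q)
triangleFree-colourable zero    G free ω = 3K₂K₃Free-4-colourable _ G free ω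
triangleFree-colourable (suc q) G free ω with edge? G
... | inj₂ none = weaken G (s≤s z≤n) (edgeless-colourable G none)
... | inj₁ (a , b , ab) = weaken G (≤-reflexive (cong (4 +_) (sym (cong suc (+-suc q (q + 0))))))
  (combine (triangleFree-nbhd G ω a) (triangleFree-nbhd G ω b)
    (triangleFree-colourable q (pull G (Sub.emb rest)) (rest-matchingFree free) (pull-ω≤ G _ ω)))
  where open AtEdge G a b ab

2p∸2 : ∀ q → 4 + 2 * q ≡ 2 * (3 + q) ∸ 2
2p∸2 q = sym (trans (cong (_∸ 2) (solve 1 (λ q → con 2 :* (con 3 :+ q) := con 2 :+ (con 4 :+ con 2 :* q)) refl q)) refl)
  where open +-*-Solver

gem-bound : ∀ p {n} (G : SimpleGraph n) m → MatchingFree G (2 + p) → GemFree G → ω≤ G m → Colourable G (g (2 + p) m)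
gem-bound zero G 0 free gem ω = empty-colourable G ω _
gem-bound zero G 1 free gem ω = ω≤1-colourable G ω
gem-bound zero G 2 free gem ω = 2K₂K₃Free-colourable G free ω
gem-bound zero G (suc (suc (suc m))) free gem ω with maximum-clique G (3 + m) ω
... | a ∷ b ∷ c ∷ xs , cl , len , ω′ = weaken G len
  (MaximumClique.gemFree-colourable G free (lookup (a ∷ b ∷ c ∷ xs)) (clique-lookup G cl) ω′ gem third
    zero (suc zero) λ ())
-- With fewer than three clique members there is no third one to complete a gem; these cases are
-- coloured directly.
... | [] , _ , _ , ω′ = empty-colourable G ω′ _
... | _ ∷ [] , _ , _ , ω′ = weaken G (s≤s z≤n) (ω≤1-colourable G ω′)
... | _ ∷ _ ∷ [] , _ , _ , ω′ = weaken G (s≤s (s≤s (s≤s z≤n))) (2K₂K₃Free-colourable G free ω′)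
gem-bound (suc p) G 0 free gem ω = empty-colourable G ω _
gem-bound (suc p) G 1 free gem ω = ω≤1-colourable G ω
gem-bound (suc p) G 2 free gem ω = weaken G (≤-reflexive (2p∸2 p)) (triangleFree-colourable p G free ω)
gem-bound (suc p) G (suc (suc (suc m))) free gem ω with edge? G
... | inj₂ none = weaken G (≤-trans (≤-trans (s≤s z≤n) (≤-reflexive (sym (cong (_∸ 2) (*-comm 2 (3 + m))))))
                                    (m≤n+m _ (g (2 + p) (3 + m)))) (edgeless-colourable G none)
... | inj₁ (a , b , ab) = weaken G (≤-reflexive (arith (g (2 + p) (3 + m))))
  (combine (gemFree-nbhd G gem ω a) (gemFree-nbhd G gem ω b)
    (gem-bound p (pull G (Sub.emb rest)) (3 + m) (rest-matchingFree free) (pull-gemFree G _ gem) (pull-ω≤ G _ ω)))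
  where
  open AtEdge G a b ab
  arith : ∀ x → (2 + m) + ((2 + m) + x) ≡ x + (2 * (3 + m) ∸ 2)
  arith x = trans (solve 2 (λ m x → (con 2 :+ m) :+ ((con 2 :+ m) :+ x) := x :+ (con 4 :+ con 2 :* m)) refl m x)
                  (cong (x +_) (2p∸2 m))
    where open +-*-Solver

triangle? : ∀ {n} (G : SimpleGraph n) →
  (∃ λ a → ∃ λ b → ∃ λ c → adj G a b ≡ true × adj G a c ≡ true × adj G b c ≡ true) ⊎ ω≤ G 2
triangle? G with any? (λ a → any? λ b → any? λ c → (adj G a b ≟ᵇ true) ×-dec (adj G a c ≟ᵇ true) ×-dec (adj G b c ≟ᵇ true))
... | yes t = inj₁ t
... | no ¬t = inj₂ λ where
  []                 _                                        → z≤n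
  (_ ∷ [])           _                                        → s≤s z≤n
  (_ ∷ _ ∷ [])       _                                        → s≤s (s≤s z≤n)
  (a ∷ b ∷ c ∷ xs) ((ab ∷ ac ∷ _) ∷ (bc ∷ _) ∷ _) → ⊥-elim (¬t (a , b , c , ab , ac , bc))

module AtTriangle {n} (G : SimpleGraph n) {m p} (free : MatchingFree G (3 + p)) (K₂P₄ : K₂P₄Free G) (ω : ω≤ G (2 + m))
  (a b c : Fin n) (ab : adj G a b ≡ true) (ac : adj G a c ≡ true) (bc : adj G b c ≡ true) where

  both : Fin n → Fin n → Fin n → Bool
  both x y v = adj G v x ∧ adj G v y

  only : Fin n → Fin n → Fin n → Fin n → Bool
  only x y z v = adj G v x ∧ (not (adj G v y) ∧ not (adj G v z))

  ∧-split : ∀ {x y} → x ∧ y ≡ true → x ≡ true × y ≡ true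
  ∧-split {true} e = refl , e

  both-colOn : ∀ x y → adj G x y ≡ true → ColOn G (both x y) m
  both-colOn x y xy = sub-colOn G S (P₄Free-colourable (pull G emb) m
    (λ {i} {j} {k} {l} p → K₂P₄ xy (joined (near₁ i) (near₁ j) (near₁ k) (near₁ l))
      (joined (near₂ i) (near₂ j) (near₂ k) (near₂ l)) (pull-path G emb p))
    (sub-ω≤ G S (x ∷ y ∷ []) ((xy ∷ []) ∷ [] ∷ [])
      (λ v e → ~-sym G (proj₁ (∧-split e)) ∷ ~-sym G (proj₂ (∧-split {adj G v x} e)) ∷ []) ω))
    where
    S = sub G (both x y)
    open Sub S
    near₁ : ∀ i → adj G x (emb i) ≡ true
    near₁ i = ~-sym G (proj₁ (∧-split (inside i)))
    near₂ : ∀ i → adj G y (emb i) ≡ true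
    near₂ i = ~-sym G (proj₂ (∧-split {adj G (emb i) x} (inside i)))

  -- The edge yz is apart from the set, which lowers p. As x is adjacent to the whole set, a gem in
  -- it with hub k would give a K₂ + P₄ with the edge xk.
  only-colOn : ∀ x y z → adj G y z ≡ true → ColOn G (only x y z) (g (2 + p) (1 + m))
  only-colOn x y z yz = sub-colOn G S (gem-bound p (pull G emb) (1 + m)
    (sub-matchingFree G S y z yz (λ v e → AtEdge.neither-far G y z yz v (proj₂ (∧-split {adj G v x} e))) free)
    (λ {k} {a′} {b′} {c′} {d′} j q → K₂P₄ (near k)
      (joined (near a′) (near b′) (near c′) (near d′)) (pull-joined G emb j) (pull-path G emb q))
    (sub-ω≤ G S (x ∷ []) ([] ∷ []) (λ v e → ~-sym G (proj₁ (∧-split e)) ∷ []) ω))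
    where
    S = sub G (only x y z)
    open Sub S
    near : ∀ i → adj G x (emb i) ≡ true
    near i = ~-sym G (proj₁ (∧-split (inside i)))

  open AtEdge G a b ab

  -- A vertex adjacent to c alone is already in `neither`, so five adjacency-based sets besides it
  -- are enough.
  covered₆ : ∀ v → both a b v ∨ (both a c v ∨ (both b c v ∨ (only a b c v ∨ (only b a c v ∨ neither v)))) ≡ true
  covered₆ v with adj G v a | adj G v b | adj G v c
  ... | true  | true  | _     = refl
  ... | true  | false | true  = refl
  ... | true  | false | false = refl
  ... | false | true  | true  = refl
  ... | false | true  | false = refl
  ... | false | false | _     = refl

  combine₆ : ∀ {k} → Colourable (pull G (Sub.emb rest)) k →
    Colourable G (m + (m + (m + (g (2 + p) (1 + m) + (g (2 + p) (1 + m) + k)))))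
  combine₆ C = colOn-all G covered₆
    (colOn-∨ G (both-colOn a b ab) (colOn-∨ G (both-colOn a c ac) (colOn-∨ G (both-colOn b c bc)
      (colOn-∨ G (only-colOn a b c bc) (colOn-∨ G (only-colOn b a c ac) (sub-colOn G rest C))))))

-- The triangle recurrence at m = 3. In terms of q = p - 3 the value 2p² - 3p + 4 becomes 2q² + 9q +
-- 13, which is free of truncated subtraction.
f-three : ∀ p → 1 + (1 + (1 + (g (2 + p) 2 + (g (2 + p) 2 + f (2 + p) 3)))) ≡ f (3 + p) 3
f-three zero    = refl
f-three (suc p) = trans
  (cong₂ (λ x y → 3 + (x + (x + y))) (sym (2p∸2 p)) (closed p))
  (trans (solve 1 (λ p → con 3 :+ ((con 4 :+ con 2 :* p) :+ ((con 4 :+ con 2 :* p) :+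
                           (con 2 :* p :* p :+ con 9 :* p :+ con 13))) :=
                         con 2 :* (con 1 :+ p) :* (con 1 :+ p) :+ con 9 :* (con 1 :+ p) :+ con 13) refl p)
         (sym (closed (suc p))))
  where
  open +-*-Solver
  closed : ∀ q → f (3 + q) 3 ≡ 2 * q * q + 9 * q + 13
  closed q = trans
    (cong (λ z → z ∸ 3 * (3 + q) + 4)
      (solve 1 (λ q → con 2 :* (con 3 :+ q) :* (con 3 :+ q) :=
                      (con 2 :* q :* q :+ con 9 :* q :+ con 9) :+ con 3 :* (con 3 :+ q)) refl q))
    (trans (cong (_+ 4) (m+n∸n≡m (2 * q * q + 9 * q + 9) (3 * (3 + q))))
      (solve 1 (λ q → con 2 :* q :* q :+ con 9 :* q :+ con 9 :+ con 4 := con 2 :* q :* q :+ con 9 :* q :+ con 13) refl q))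

f-four : ∀ p k → (2 + k) + ((2 + k) + ((2 + k) + (g (2 + p) (3 + k) + (g (2 + p) (3 + k) + f (2 + p) (4 + k))))) ≡ f (3 + p) (4 + k)
f-four p k = trans
  (solve 3 (λ k x y → (con 2 :+ k) :+ ((con 2 :+ k) :+ ((con 2 :+ k) :+ (x :+ (x :+ y)))) :=
                      y :+ con 2 :* x :+ (con 6 :+ con 3 :* k)) refl k (g (2 + p) (3 + k)) (f (2 + p) (4 + k)))
  (cong (f (2 + p) (4 + k) + 2 * g (2 + p) (3 + k) +_)
    (sym (trans (cong (_∸ 6) (solve 1 (λ k → con 3 :* (con 4 :+ k) := (con 6 :+ con 3 :* k) :+ con 6) refl k))
                (m+n∸n≡m (6 + 3 * k) 6))))
  where open +-*-Solver

-- Serves graphs without triangles under a bound of at least 3 on the clique number. With 2 + p in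
-- the role of p the left side is 2p - 2, and raising p by one adds at least two colours to `f`
-- through the sets of common neighbours.
triangleFree≤f : ∀ p m → 2 + 2 * p ≤ f (2 + p) (3 + m)
triangleFree≤f zero    zero    = s≤s (s≤s z≤n)
triangleFree≤f zero    (suc m) = s≤s (s≤s z≤n)
triangleFree≤f (suc p) zero    = subst (2 + 2 * suc p ≤_) (f-three p)
  (step (triangleFree≤f p 0) (s≤s (s≤s (z≤n {1}))) (g (2 + p) 2))
  where
  step : ∀ {x y} → 2 + 2 * p ≤ x → 2 ≤ y → ∀ z → 2 + 2 * suc p ≤ y + (z + (z + x))
  step {x} {y} h h′ z = ≤-trans (≤-reflexive (solve 1 (λ p → con 2 :+ con 2 :* (con 1 :+ p) := con 2 :+ (con 2 :+ con 2 :* p)) refl p))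
    (+-mono-≤ h′ (≤-trans h (≤-trans (m≤n+m x z) (m≤n+m _ z))))
    where open +-*-Solver
triangleFree≤f (suc p) (suc m) = subst (2 + 2 * suc p ≤_) (f-four p m)
  (≤-trans (≤-reflexive (solve 1 (λ p → con 2 :+ con 2 :* (con 1 :+ p) := con 2 :+ (con 2 :+ con 2 :* p)) refl p))
    (+-mono-≤ {2} {2 + m} (s≤s (s≤s z≤n))
      (≤-trans (triangleFree≤f p (suc m))
        (≤-trans (m≤n+m _ (g (2 + p) (3 + m))) (≤-trans (m≤n+m _ (g (2 + p) (3 + m)))
          (≤-trans (m≤n+m _ (2 + m)) (m≤n+m _ (2 + m))))))))
  where open +-*-Solver

bound : ∀ p {n} (G : SimpleGraph n) m → MatchingFree G (2 + p) → K₂P₄Free G → ω≤ G m → Colourable G (f (2 + p) m)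
bound zero G 0 free K₂P₄ ω = empty-colourable G ω _
bound zero G 1 free K₂P₄ ω = ω≤1-colourable G ω
bound zero G 2 free K₂P₄ ω = 2K₂K₃Free-colourable G free ω
bound zero G 3 free K₂P₄ ω = 2K₂K₄Free-4-colourable _ G free ω
bound zero G (suc (suc (suc (suc m)))) free K₂P₄ ω with maximum-clique G (4 + m) ω
... | a ∷ b ∷ c ∷ d ∷ xs , cl , len , ω′ = weaken G (+-mono-≤ len (≤-refl {2}))
  (K₂P₄Free-colourable G free K₂P₄ (lookup (a ∷ b ∷ c ∷ d ∷ xs)) (clique-lookup G cl) ω′)
-- A clique of at most three vertices has no room for the mates, but then four colours suffice.
... | []             , _ , _ , ω′ = weaken G (m≤m+n 4 (m + 2)) (2K₂K₄Free-4-colourable _ G free (weaken-ω G z≤n ω′))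
... | _ ∷ []         , _ , _ , ω′ = weaken G (m≤m+n 4 (m + 2)) (2K₂K₄Free-4-colourable _ G free (weaken-ω G (s≤s z≤n) ω′))
... | _ ∷ _ ∷ []     , _ , _ , ω′ = weaken G (m≤m+n 4 (m + 2)) (2K₂K₄Free-4-colourable _ G free (weaken-ω G (s≤s (s≤s z≤n)) ω′))
... | _ ∷ _ ∷ _ ∷ [] , _ , _ , ω′ = weaken G (m≤m+n 4 (m + 2)) (2K₂K₄Free-4-colourable _ G free ω′)
bound (suc p) G 0 free K₂P₄ ω = empty-colourable G ω _
bound (suc p) G 1 free K₂P₄ ω = ω≤1-colourable G ω
bound (suc p) G 2 free K₂P₄ ω = weaken G (≤-reflexive (2p∸2 p)) (triangleFree-colourable p G free ω)
bound (suc p) G (suc (suc (suc m))) free K₂P₄ ω with triangle? G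
... | inj₂ ω₂ = weaken G (≤-trans (≤-reflexive (cong (2 +_) (sym (cong suc (+-suc p (p + 0)))))) (triangleFree≤f (suc p) m))
                  (triangleFree-colourable p G free ω₂)
... | inj₁ (a , b , c , ab , ac , bc) = weaken G (≤-reflexive (total m))
  (combine₆ (bound p (pull G (Sub.emb rest)) (3 + m) (rest-matchingFree free) (pull-K₂P₄Free G _ K₂P₄) (pull-ω≤ G _ ω)))
  where
  open AtTriangle G free K₂P₄ ω a b c ab ac bc
  open AtEdge G a b ab using (rest; rest-matchingFree)
  total : ∀ m → (1 + m) + ((1 + m) + ((1 + m) + (g (2 + p) (2 + m) + (g (2 + p) (2 + m) + f (2 + p) (3 + m))))) ≡ f (3 + p) (3 + m)
  total zero    = f-three p
  total (suc m) = f-four p m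

-- From excluded induced copies to the list form of the hypotheses

≡ᵇ-true : ∀ {a b} → a ≡ b → (a ≡ᵇ b) ≡ true
≡ᵇ-true {a} {b} e = Equivalence.to T-≡ (≡⇒≡ᵇ a b e)

≡ᵇ-false : ∀ {a b} → a ≢ b → (a ≡ᵇ b) ≡ false
≡ᵇ-false {a} {b} a≢b = ¬-not λ e → a≢b (≡ᵇ⇒≡ a b (Equivalence.from T-≡ e))

module _ {n} (G : SimpleGraph n) where

  cliqueNumber⇒ω≤ : ∀ {w} → (HasClique G (suc w) → ⊥) → ω≤ G w
  cliqueNumber⇒ω≤ {w} none xs c with length xs ≤? w
  ... | yes le = le
  ... | no gt  = ⊥-elim (none ((λ i → lookup xs (inject≤ i le)) , inj , λ i j i≢j → near i≢j))
    where
    le : suc w ≤ length xs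
    le = ≰⇒> gt
    near : ∀ {i j} → i ≢ j → adj G (lookup xs (inject≤ i le)) (lookup xs (inject≤ j le)) ≡ true
    near i≢j = clique-lookup G c (i≢j ∘ inject≤-injective le le _ _)
    inj : Injective _≡_ _≡_ (λ i → lookup xs (inject≤ i le))
    inj {i} {j} e with i ≟ᶠ j
    ... | yes i≡j = i≡j
    ... | no i≢j  = ⊥-elim (¬~-self G (trans (cong (adj G _) e) (near i≢j)))

  -- Following the numbering of `pK₂`, index i goes to end i mod 2 of edge number i / 2 in the list.
  free⇒matchingFree : ∀ p → Free G (2 * p) (pK₂ p) → MatchingFree G p
  free⇒matchingFree p free es edges apart with length es <? p
  ... | yes lt = lt
  ... | no ge  = ⊥-elim (free (φ , inj , agree))
    where
    le : p ≤ length es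
    le = ≮⇒≥ ge
    half : Fin (2 * p) → Fin p
    half i = fromℕ< (m<n*o⇒m/o<n (subst (toℕ i <_) (*-comm 2 p) (toℕ<n i)))
    end : ℕ → Fin n × Fin n → Fin n
    end zero    = proj₁
    end (suc _) = proj₂
    pair : Fin p → Fin n × Fin n
    pair k = lookup es (inject≤ k le)
    φ : Fin (2 * p) → Fin n
    φ i = end (toℕ i % 2) (pair (half i))
    ends : ∀ a b e → a < 2 → b < 2 → IsEdge G e → adj G (end a e) (end b e) ≡ not (a ≡ᵇ b)
    ends 0 0 e _ _ h = irrefl G _
    ends 0 1 e _ _ h = h
    ends 1 0 e _ _ h = ~-sym G h
    ends 1 1 e _ _ h = irrefl G _
    ends 0 (suc (suc _)) _ _ (s≤s (s≤s ())) _
    ends 1 (suc (suc _)) _ _ (s≤s (s≤s ())) _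
    ends (suc (suc _)) _ _ (s≤s (s≤s ())) _ _
    ends-apart : ∀ a b {e e′} → Apart G e e′ → adj G (end a e) (end b e′) ≡ false
    ends-apart zero    zero    (h , _)         = h
    ends-apart zero    (suc _) (_ , h , _)     = h
    ends-apart (suc _) zero    (_ , _ , h , _) = h
    ends-apart (suc _) (suc _) (_ , _ , _ , h) = h
    edge : ∀ k → IsEdge G (pair k)
    edge k = All.lookup edges (∈-lookup (inject≤ k le))
    Apart-sym : ∀ {e e′} → Apart G e e′ → Apart G e′ e
    Apart-sym (h₁ , h₂ , h₃ , h₄) = ~-sym G h₁ , ~-sym G h₃ , ~-sym G h₂ , ~-sym G h₄
    far : ∀ {k l} → k ≢ l → Apart G (pair k) (pair l)
    far k≢l = lookup-pairs Apart-sym apart (k≢l ∘ inject≤-injective le le _ _)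
    half-≡ : ∀ {i j} → half i ≡ half j → toℕ i / 2 ≡ toℕ j / 2
    half-≡ = fromℕ<-injective _ _ _ _
    parity : ∀ {i j} → toℕ i / 2 ≡ toℕ j / 2 → toℕ i % 2 ≡ toℕ j % 2 → toℕ i ≡ toℕ j
    parity {i} {j} q r = trans (m≡m%n+[m/n]*n (toℕ i) 2) (trans (cong₂ (λ x y → x + y * 2) r q) (sym (m≡m%n+[m/n]*n (toℕ j) 2)))
    not-same : ∀ i j → toℕ i / 2 ≡ toℕ j / 2 → not (toℕ i % 2 ≡ᵇ toℕ j % 2) ≡ not (toℕ i ≡ᵇ toℕ j)
    not-same i j q with toℕ i ≟ toℕ j
    ... | yes e = cong not (trans (≡ᵇ-true (cong (_% 2) e)) (sym (≡ᵇ-true e)))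
    ... | no ne = cong not (trans (≡ᵇ-false (ne ∘ parity {i} {j} q)) (sym (≡ᵇ-false ne)))
    agree : ∀ i j → adj G (φ i) (φ j) ≡ pK₂ p i j
    agree i j with half i ≟ᶠ half j
    ... | yes e = trans (cong (λ k → adj G (φ i) (end (toℕ j % 2) (pair k))) (sym e))
      (trans (ends (toℕ i % 2) (toℕ j % 2) _ (m%n<n (toℕ i) 2) (m%n<n (toℕ j) 2) (edge (half i)))
        (trans (not-same i j (half-≡ {i} {j} e)) (cong (_∧ not (toℕ i ≡ᵇ toℕ j)) (sym (≡ᵇ-true (half-≡ {i} {j} e))))))
    ... | no ne = trans (ends-apart (toℕ i % 2) (toℕ j % 2) (far ne))
      (cong (_∧ not (toℕ i ≡ᵇ toℕ j)) (sym (≡ᵇ-false (λ q → ne (fromℕ<-cong _ _ q _ _)))))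
    other : ∀ a e → IsEdge G e → ∃ λ b → adj G (end a e) (end b e) ≡ true
    other zero    e h = 1 , h
    other (suc _) e h = 0 , ~-sym G h
    inj : Injective _≡_ _≡_ φ
    inj {i} {j} e with half i ≟ᶠ half j
    -- On different edges: the other end of the edge of φ i is adjacent to φ i but not to φ j.
    ... | no ne = let b , h = other (toℕ i % 2) _ (edge (half i)) in
      ⊥-elim (true≢false h (trans (cong (λ v → adj G v (end b (pair (half i)))) e) (ends-apart (toℕ j % 2) b (far (ne ∘ sym)))))
    -- On the same edge: distinct indices would have adjacent images, and no vertex is adjacent to
    -- itself.
    ... | yes q = toℕ-injective (≡ᵇ⇒≡ _ _ (Equivalence.from T-≡ (not-injective
      (trans (sym (not-same i j (half-≡ {i} {j} q))) (trans (sym (ends (toℕ i % 2) (toℕ j % 2) _ (m%n<n (toℕ i) 2) (m%n<n (toℕ j) 2) (edge (half i))))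
        (trans (cong (λ k → adj G (φ i) (end (toℕ j % 2) (pair k))) q) (trans (cong (adj G (φ i)) (sym e)) (irrefl G (φ i)))))))))
      where
      not-injective : ∀ {b} → not b ≡ false → b ≡ true
      not-injective {true} _ = refl

  -- Spares a separate proof of injectivity: under a map that preserves adjacency and nonadjacency,
  -- vertices with equal images have equal rows. The finite check is done by evaluation.
  K₂+P₄-twinfree : ∀ i j → (∀ l → K₂+P₄ i l ≡ K₂+P₄ j l) → i ≡ j
  K₂+P₄-twinfree = from-yes (all? λ i → all? λ j → (all? λ l → K₂+P₄ i l ≟ᵇ K₂+P₄ j l) →-dec (i ≟ᶠ j))

  free⇒K₂P₄Free : Free G 6 K₂+P₄ → K₂P₄Free G
  free⇒K₂P₄Free free {k} {l} {a} {b} {c} {d} kl (joined ka kb kc kd) (joined la lb lc ld) (path ab bc cd ac ad bd) =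
    free (φ , inj , agree)
    where
    φ : Fin 6 → Fin n
    φ = lookup (k ∷ l ∷ a ∷ b ∷ c ∷ d ∷ [])
    agree : ∀ i j → adj G (φ i) (φ j) ≡ K₂+P₄ i j
    agree 0F 0F = irrefl G _
    agree 0F 1F = kl
    agree 0F 2F = ka
    agree 0F 3F = kb
    agree 0F 4F = kc
    agree 0F 5F = kd
    agree 1F 0F = ~-sym G kl
    agree 1F 1F = irrefl G _
    agree 1F 2F = la
    agree 1F 3F = lb
    agree 1F 4F = lc
    agree 1F 5F = ld
    agree 2F 0F = ~-sym G ka
    agree 2F 1F = ~-sym G la
    agree 2F 2F = irrefl G _
    agree 2F 3F = ab
    agree 2F 4F = ac
    agree 2F 5F = ad
    agree 3F 0F = ~-sym G kb
    agree 3F 1F = ~-sym G lb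
    agree 3F 2F = ~-sym G ab
    agree 3F 3F = irrefl G _
    agree 3F 4F = bc
    agree 3F 5F = bd
    agree 4F 0F = ~-sym G kc
    agree 4F 1F = ~-sym G lc
    agree 4F 2F = ~-sym G ac
    agree 4F 3F = ~-sym G bc
    agree 4F 4F = irrefl G _
    agree 4F 5F = cd
    agree 5F 0F = ~-sym G kd
    agree 5F 1F = ~-sym G ld
    agree 5F 2F = ~-sym G ad
    agree 5F 3F = ~-sym G bd
    agree 5F 4F = ~-sym G cd
    agree 5F 5F = irrefl G _
    inj : Injective _≡_ _≡_ φ
    inj {i} {j} e = K₂+P₄-twinfree i j λ v → trans (sym (agree i v)) (trans (cong (λ x → adj G x (φ v)) e) (agree j v))

theorem3p5 : (p : ℕ) → p ≥ 2 → (n : ℕ) → (G : SimpleGraph n) →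
    Free G (2 * p) (pK₂ p) → Free G 6 K₂+P₄ →
    (w : ℕ) → IsCliqueNumber G w → Colourable G (f p w)
theorem3p5 (suc (suc p)) _ n G free free′ w (_ , none) =
  bound p G w (free⇒matchingFree G (2 + p) free) (free⇒K₂P₄Free G free′) (cliqueNumber⇒ω≤ G none)
theorem3p5 1 (s≤s ())
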